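{- For positive integers $\ell,m$, let $\lambda_{\ell,m}\in\mathrm{NC}(\ell m)$ be the interval partition consisting of $m$ blocks of size $\ell$ each: $$\lambda_{\ell,m}=\bigl\{\{1,\ldots,\ell\},\{\ell+1,\ldots,2\ell\},\ldots,\{(m-1)\ell+1,\ldots,m\ell\}\bigr\}.$$ Then the number of meandric partners of $\lambda_{\ell,m}$, that is, the number of $\rho\in\mathrm{NC}(\ell m)$ with $d_H(\lambda_{\ell,m},\rho)=\ell m-1$, is equal to $\mathrm{FCat}_m^{(\ell)}\cdot\ell^{m-1}$, where $$\mathrm{FCat}_m^{(\ell)}:=\frac{1}{(\ell-1)m+1}\binom{\ell m}{m}.$$
   Context: For a positive integer $n$, a partition $\pi$ of $\{1,\ldots,n\}$ is non-crossing if there are no two distinct blocks $V,W$ of $\pi$ and numbers $a<b<c<d$ with $a,c\in V$ and $b,d\in W$. $\mathrm{NC}(n)$ is the set of non-crossing partitions of $\{1,\ldots,n\}$, partially ordered by $\pi\le\rho$ iff every block of $\pi$ is contained in a block of $\rho$. The Hasse diagram $\mathcal{H}_n$ is the undirected graph with vertex set $\mathrm{NC}(n)$ in which $\pi_1,\pi_2$ are joined by an edge iff one of them covers the other in $(\mathrm{NC}(n),\le)$; $d_H(\pi,\rho)$ is the graph distance in $\mathcal{H}_n$. -}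

module Defs where

open import Level using (Level; 0ℓ; _⊔_)
open import Data.Bool.Properties using () renaming (_≟_ to _≟ᵇ_)
open import Data.Nat.Base
  using (ℕ; zero; suc; _*_; _∸_; _≤_; _<_; NonZero; s≤s⁻¹)
open import Data.Nat.Properties as ℕ using (_≤?_; _<?_)
open import Data.Nat.DivMod using (_/_; m≡m%n+[m/n]*n; m%n<n; m/n*n≤m; m<n*o⇒m/o<n)
open import Data.Nat.Combinatorics using (_C_)
open import Data.Integer.Base using (+_)
open import Data.Rational.Base as ℚ using (ℚ)
open import Data.Fin.Base as Fin using (Fin; toℕ; fromℕ<)
import Data.Fin.Properties as Fin
open import Data.Fin.Subset using (Subset; inside; _∈_; _⊆_; Nonempty)
open import Data.Fin.Subset.Properties using (⊆-refl; ⊆-trans; ⊆-antisym)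
open import Data.Product.Base using (Σ; ∃; ∃-syntax; _×_; _,_; proj₁; proj₂)
open import Data.Sum.Base using (_⊎_)
open import Data.Vec.Base using (tabulate)
open import Data.Vec.Properties using (≡-dec; lookup∘tabulate; []=⇒lookup; lookup⇒[]=)
open import Function.Bundles using (Bijection)
open import Relation.Binary.Bundles using (Setoid; Poset)
import Relation.Binary.Construct.On as On
import Relation.Binary.Properties.Poset as PosetProperties
open import Relation.Binary.PropositionalEquality
  using (_≡_; _≢_; refl; sym; trans; cong; subst; setoid)
open import Relation.Nullary using (¬_; Dec; does; yes; _×-dec_)
open import Relation.Nullary.Decidable using (dec-true; decidable-stable)
open import Relation.Unary using (Pred; _≐_)
open import Relation.Unary.Properties using (≐-refl; ≐-sym; ≐-trans)

-- Partitions of {1,…,n}, with the labels shifted down by one to Fin n.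
-- Block need not be assumed decidable: a nonempty V is a block iff it equals
-- the block that cover gives for an element of V.

record Partition (n : ℕ) : Set₁ where
  field
    Block    : Pred (Subset n) 0ℓ
    nonempty : ∀ {V} → Block V → Nonempty V
    disjoint : ∀ {V W} → Block V → Block W → V ≢ W → ∀ {x} → ¬ (x ∈ V × x ∈ W)
    cover    : ∀ x → ∃[ V ] Block V × x ∈ V

  sameBlock : ∀ {V W} → Block V → Block W → ∀ {x} → x ∈ V → x ∈ W → V ≡ W
  sameBlock bV bW x∈V x∈W =
    decidable-stable (≡-dec _≟ᵇ_ _ _) λ V≢W → disjoint bV bW V≢W (x∈V , x∈W)

open Partition using (Block)

NonCrossing : ∀ {n} → Partition n → Set
NonCrossing π = ∀ {V W} → Block π V → Block π W → V ≢ W →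
  ∀ {a b c d} → a Fin.< b → b Fin.< c → c Fin.< d →
  ¬ ((a ∈ V × c ∈ V) × (b ∈ W × d ∈ W))

NC : ℕ → Set₁
NC n = Σ (Partition n) NonCrossing

-- Two partitions are identified when they have the same blocks; the proof
-- fields of Partition and the proof of NonCrossing are irrelevant.

infix 4 _≈_ _⊑_

_≈_ : ∀ {n} → NC n → NC n → Set
(π , _) ≈ (ρ , _) = Block π ≐ Block ρ

_⊑_ : ∀ {n} → NC n → NC n → Set
(π , _) ⊑ (ρ , _) = ∀ {V} → Block π V → ∃[ W ] Block ρ W × V ⊆ W

⊑-antisym : ∀ {n} (π ρ : NC n) → π ⊑ ρ → ρ ⊑ π → π ≈ ρ
⊑-antisym (π , _) (ρ , _) π⊑ρ ρ⊑π = half π ρ π⊑ρ ρ⊑π , half ρ π ρ⊑π π⊑ρ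
  where
  half : ∀ {n} (π ρ : Partition n) →
         (∀ {V} → Block π V → ∃[ W ] Block ρ W × V ⊆ W) →
         (∀ {V} → Block ρ V → ∃[ W ] Block π W × V ⊆ W) →
         ∀ {V} → Block π V → Block ρ V
  half π ρ f g {V} bV with f bV
  ... | W , bW , V⊆W with g bW
  ...   | V′ , bV′ , W⊆V′ = subst (Block ρ) (⊆-antisym W⊆V V⊆W) bW
    where
    W⊆V : W ⊆ V
    W⊆V with Partition.nonempty π bV
    ... | x , x∈V with Partition.sameBlock π bV bV′ x∈V (W⊆V′ (V⊆W x∈V))
    ...   | refl = W⊆V′

NC-poset : ℕ → Poset _ _ _
NC-poset n = record
  { Carrier = NC n
  ; _≈_     = _≈_
  ; _≤_     = _⊑_
  ; isPartialOrder = record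
    { isPreorder = record
      { isEquivalence = record { refl = ≐-refl ; sym = ≐-sym ; trans = ≐-trans }
      ; reflexive     = λ (π⊆ρ , _) {V} bV → V , π⊆ρ bV , ⊆-refl
      ; trans         = λ π⊑ρ ρ⊑σ bV →
          let (W , bW , V⊆W) = π⊑ρ bV
              (X , bX , W⊆X) = ρ⊑σ bW
          in X , bX , ⊆-trans V⊆W W⊆X
      }
    ; antisym = λ {π} {ρ} → ⊑-antisym π ρ
    }
  }

module HasseDiagram {a ℓ₁ ℓ₂ : Level} (P : Poset a ℓ₁ ℓ₂) where
  open Poset P using (Carrier) renaming (_≈_ to _≈ₚ_)
  open PosetProperties P using () renaming (_<_ to _<ₚ_)

  _CoveredBy_ : Carrier → Carrier → Set (a ⊔ ℓ₁ ⊔ ℓ₂)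
  x CoveredBy y = x <ₚ y × ¬ (∃[ z ] x <ₚ z × z <ₚ y)

  Adjacent : Carrier → Carrier → Set (a ⊔ ℓ₁ ⊔ ℓ₂)
  Adjacent x y = x CoveredBy y ⊎ y CoveredBy x

  data Walk : ℕ → Carrier → Carrier → Set (a ⊔ ℓ₁ ⊔ ℓ₂) where
    stop : ∀ {x y} → x ≈ₚ y → Walk zero x y
    step : ∀ {k x y z} → Adjacent x y → Walk k y z → Walk (suc k) x z

  -- Graph distance as a relation, so that no connectedness has to be proved
  -- in advance: IsDistance x y k says d(x,y) = k.

  IsDistance : Carrier → Carrier → ℕ → Set (a ⊔ ℓ₁ ⊔ ℓ₂)
  IsDistance x y k = Walk k x y × (∀ j → Walk j x y → k ≤ j)

d[_,_]≡_ : ∀ {n} → NC n → NC n → ℕ → Set₁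
d[_,_]≡_ {n} = HasseDiagram.IsDistance (NC-poset n)

MeandricPartner : ∀ {n} → NC n → NC n → Set₁
MeandricPartner {n} π ρ = d[ π , ρ ]≡ (n ∸ 1)

MeandricPartners : ∀ {n} → NC n → Setoid _ _
MeandricPartners {n} π =
  On.setoid {B = ∃ (MeandricPartner π)} (Poset.Eq.setoid (NC-poset n)) proj₁

HasCardinality : ∀ {a ℓ} → Setoid a ℓ → ℕ → Set (a ⊔ ℓ)
HasCardinality S N = Bijection (setoid (Fin N)) S

module _ (ℓ m : ℕ) where

  -- With labels starting at 0, the k-th block (k = 0,…,m-1) is
  -- { kℓ , … , (k+1)ℓ - 1 }.

  InInterval : Fin m → Fin (ℓ * m) → Set
  InInterval k i = toℕ k * ℓ ≤ toℕ i × toℕ i < suc (toℕ k) * ℓ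

  inInterval? : ∀ k i → Dec (InInterval k i)
  inInterval? k i = (toℕ k * ℓ ≤? toℕ i) ×-dec (toℕ i <? suc (toℕ k) * ℓ)

  interval : Fin m → Subset (ℓ * m)
  interval k = tabulate λ i → does (inInterval? k i)

  ∈-interval⁺ : ∀ k {i} → InInterval k i → i ∈ interval k
  ∈-interval⁺ k {i} p = lookup⇒[]= i (interval k)
    (trans (lookup∘tabulate _ i) (dec-true (inInterval? k i) p))

  ∈-interval⁻ : ∀ k {i} → i ∈ interval k → InInterval k i
  ∈-interval⁻ k {i} i∈ = invert (inInterval? k i)
    (trans (sym (lookup∘tabulate _ i)) ([]=⇒lookup i∈))
    where
    invert : ∀ {A : Set} (a? : Dec A) → does a? ≡ inside → A
    invert (yes a) _ = a

  interval-unique : ∀ k k′ {i} → InInterval k i → InInterval k′ i → k ≡ k′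
  interval-unique k k′ (lo , hi) (lo′ , hi′) = Fin.toℕ-injective
    (ℕ.≤-antisym (bound (toℕ k) (toℕ k′) lo hi′) (bound (toℕ k′) (toℕ k) lo′ hi))
    where
    bound : ∀ p q {x} → p * ℓ ≤ x → x < suc q * ℓ → p ≤ q
    bound p q lo hi = s≤s⁻¹ (ℕ.*-cancelʳ-< ℓ p (suc q) (ℕ.≤-<-trans lo hi))

module _ (ℓ m : ℕ) .{{_ : NonZero ℓ}} where

  intervalPartition : Partition (ℓ * m)
  intervalPartition = record
    { Block    = λ V → ∃[ k ] V ≡ interval ℓ m k
    ; nonempty = λ { (k , refl) → fromℕ< (first< k) , ∈-interval⁺ ℓ m k (first∈ k) }
    ; disjoint = λ { (k , refl) (k′ , refl) V≢W (x∈V , x∈W) → V≢W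
        (cong (interval ℓ m)
          (interval-unique ℓ m k k′ (∈-interval⁻ ℓ m k x∈V) (∈-interval⁻ ℓ m k′ x∈W))) }
    ; cover    = λ i → interval ℓ m (quotient i) , (quotient i , refl)
        , ∈-interval⁺ ℓ m (quotient i) (quotient∈ i)
    }
    where
    next : ∀ (k : Fin m) → toℕ k * ℓ < suc (toℕ k) * ℓ
    next k = ℕ.*-monoˡ-< ℓ (ℕ.n<1+n (toℕ k))

    first< : ∀ (k : Fin m) → toℕ k * ℓ < ℓ * m
    first< k = subst (toℕ k * ℓ <_) (ℕ.*-comm m ℓ) (ℕ.*-monoˡ-< ℓ (Fin.toℕ<n k))

    first∈ : ∀ k → InInterval ℓ m k (fromℕ< (first< k))
    first∈ k rewrite Fin.toℕ-fromℕ< (first< k) = ℕ.≤-refl , next k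

    quotient< : ∀ (i : Fin (ℓ * m)) → toℕ i / ℓ < m
    quotient< i = m<n*o⇒m/o<n (subst (toℕ i <_) (ℕ.*-comm ℓ m) (Fin.toℕ<n i))

    quotient : Fin (ℓ * m) → Fin m
    quotient i = fromℕ< (quotient< i)

    quotient∈ : ∀ i → InInterval ℓ m (quotient i) i
    quotient∈ i rewrite Fin.toℕ-fromℕ< (quotient< i) =
      m/n*n≤m (toℕ i) ℓ ,
      subst (_< suc (toℕ i / ℓ) * ℓ) (sym (m≡m%n+[m/n]*n (toℕ i) ℓ))
        (ℕ.+-monoˡ-< (toℕ i / ℓ * ℓ) (m%n<n (toℕ i) ℓ))

  intervalPartition-nonCrossing : NonCrossing intervalPartition
  intervalPartition-nonCrossing (k , refl) bW V≢W a<b b<c _ ((a∈V , c∈V) , b∈W , _) =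
    Partition.disjoint intervalPartition (k , refl) bW V≢W (∈-interval⁺ ℓ m k b∈ , b∈W)
    where
    b∈ = ℕ.≤-trans (proj₁ (∈-interval⁻ ℓ m k a∈V)) (ℕ.<⇒≤ a<b)
       , ℕ.<-trans b<c (proj₂ (∈-interval⁻ ℓ m k c∈V))

  λ-interval : NC (ℓ * m)
  λ-interval = intervalPartition , intervalPartition-nonCrossing

-- The denominator (ℓ-1)m + 1 is written as a successor so that it is visibly
-- nonzero.

FCat : ℕ → ℕ → ℚ
FCat ℓ m = + ((ℓ * m) C m) ℚ./ suc ((ℓ ∸ 1) * m)

fromℕ : ℕ → ℚ
fromℕ k = + k ℚ./ 1

{-# OPTIONS --safe #-}

-- Merging two blocks of a non-crossing partition is a covering step of the Hasse
-- diagram, and every covering is such a merge.  Comparing the walks from λ to ρ through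
-- the finest partition, through the coarsest one and through a common upper bound shows
-- that for a meandric partner ρ of λ the blocks of λ and ρ together connect all points
-- and the number of blocks of ρ is ℓm + 1 − m: the bipartite graph of the blocks, with
-- the points as edges, is a tree.  Conversely, on a walk from λ to such a ρ the
-- merges alone have to connect the m blocks of λ, which bounds the number of up-steps.
--
-- These partitions are counted after replacing the first interval by a group of a points,
-- followed by s intervals.  The first point 0 either is alone in its block, or its next
-- neighbour is the point number p of interval number t; then 0 is identified with that
-- point.  The part enclosed between the two becomes, after a rotation of the circle, an
-- instance with group p + a and t intervals, and the part from the neighbour on an
-- instance with group ℓ − p and s − 1 − t intervals.  By convolution the numbers satisfy
-- A(a+1,s+1) = A(a,s+1) + ℓ A(a+ℓ,s), which is solved by a ℓ^s / (a+sℓ) · C(a+sℓ, s).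

module Submission where

open import Defs
open import Data.Bool.Base using (Bool; true; false)
open import Data.Bool.Properties using () renaming (_≟_ to _≟ᵇ_)
open import Data.Empty using (⊥; ⊥-elim)
open import Data.Fin.Base as Fin using (Fin; zero; suc; toℕ; fromℕ<; punchOut; punchIn)
import Data.Fin.Properties as Fin
open import Data.Fin.Subset using (Subset; _∈_)
open import Data.Fin.Subset.Properties using (⊆-antisym)
import Data.Integer.Base as ℤ
import Data.Integer.Properties as ℤ
open import Data.Nat.Base
  using (ℕ; zero; suc; _+_; _*_; _∸_; _^_; _≤_; _<_; z≤n; s≤s; z<s; NonZero)
import Data.Nat.Combinatorics as Comb
open import Data.Nat.DivMod using (_/_; _%_; m%n<n; m≡m%n+[m/n]*n; m<n*o⇒m/o<n)
open import Data.Nat.Induction using (<-rec)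
open import Data.Nat.Properties as ℕ using (≤-trans; ≤-refl; <-trans; <-irrefl; <-cmp; _<?_)
open import Data.Nat.Tactic.RingSolver using (solve-∀)
open import Data.Product.Base using (Σ; ∃; ∃-syntax; _×_; _,_; proj₁; proj₂)
import Data.Product.Base as Product
open import Data.Product.Function.Dependent.Propositional using (Σ-↔)
open import Data.Product.Function.NonDependent.Propositional using (_×-↔_)
import Data.Rational.Base as ℚ
import Data.Rational.Properties as ℚ
open import Data.Rational.Unnormalised.Base using (mkℚᵘ; *≡*)
import Data.Rational.Unnormalised.Properties as ℚᵘ
open import Data.Sum.Base using (_⊎_; inj₁; inj₂; [_,_]′)
open import Data.Sum.Function.Propositional using (_⊎-↔_)
open import Data.Vec.Base using (tabulate)
open import Data.Vec.Properties using (≡-dec; lookup∘tabulate; []=⇒lookup; lookup⇒[]=)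
open import Function.Base using (_∘_; id; case_of_)
open import Function.Bundles using (Inverse; _↔_; mk↔ₛ′)
open import Function.Construct.Composition using (_↔-∘_)
open import Function.Construct.Identity using (↔-id)
open import Relation.Binary.Bundles using (Poset)
open import Relation.Binary.Definitions using (DecidableEquality; tri<; tri≈; tri>)
import Relation.Binary.Properties.Poset as PosetProperties
open import Relation.Binary.PropositionalEquality
  using (_≡_; _≢_; refl; sym; trans; cong; cong₂; subst; module ≡-Reasoning)
open import Relation.Nullary using (¬_; Dec; does; yes; no; contradiction; _×-dec_; ¬?)
open import Relation.Nullary.Decidable using (dec-true; decidable-stable)

-- Convexity of the intervals makes connectedness a condition on plain set partitions. Neighbouring
-- points of one interval can be merged in `ρ` without a crossing, so the join of `λ` and `ρ` among
-- all partitions is itself non-crossing. For an arbitrary pair the join in NC can be coarser, and a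
-- single block there would say nothing about connectedness.
--
-- The group of arbitrary size `a` is forced by the cut. Identifying 0 with point `p` of an interval
-- fuses this interval with the group: one edge and one vertex of the tree disappear, and a tree
-- remains. The chord then divides the fused vertex, with `p + a` points on the inner and `ℓ − p`
-- points on the outer side, and the tree falls apart into two trees.
--
-- A labelling under decoding is only known to be connected, and its parts are not known to be trees
-- in advance. The recursion therefore carries the alternative that there are too few classes, which
-- the block count of a partner excludes at the very end.

private variable
  n k k′ N : ℕ
  A B : Set

-- Finite labellings compared by their kernels

infix 4 _≼_

-- The kernel of `f` is contained in that of `g`: `f` is the finer labelling. Labellings are
-- compared only in this way, which leaves the names of the classes free.
_≼_ : (Fin n → A) → (Fin n → B) → Set
f ≼ g = ∀ {x y} → f x ≡ f y → g x ≡ g y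

Onto : (Fin n → Fin k) → Set
Onto f = ∀ c → ∃[ x ] f x ≡ c

-- One chosen point in each class of `g` gives points in different classes of `f`.
onto-≤ : {f : Fin n → Fin k} {g : Fin n → Fin k′} → Onto g → f ≼ g → k′ ≤ k
onto-≤ {f = f} {g} onto f≼g = Fin.injective⇒≤ {f = f ∘ proj₁ ∘ onto} λ {c} {d} e →
  trans (sym (proj₂ (onto c))) (trans (f≼g e) (proj₂ (onto d)))

abstract
  compress : DecidableEquality A → (f : Fin n → A) →
    ∃[ k ] Σ (Fin n → Fin k) λ g → Onto g × f ≼ g × g ≼ f
  compress {n = zero} _≟_ f = 0 , (λ ()) , (λ ()) , (λ { {()} }) , (λ { {()} })
  compress {n = suc n} _≟_ f with compress _≟_ (f ∘ suc) | Fin.any? (λ i → f (suc i) ≟ f zero)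
  ... | k , g , onto , f≼g , g≼f | yes (i , fi≡f0) = k , h , onto′ , f≼h , h≼f
    where
    h : Fin (suc n) → Fin k
    h zero = g i
    h (suc j) = g j
    onto′ : Onto h
    onto′ c = let (x , e) = onto c in suc x , e
    f≼h : f ≼ h
    f≼h {zero} {zero} e = refl
    f≼h {zero} {suc y} e = f≼g (trans fi≡f0 e)
    f≼h {suc x} {zero} e = f≼g (trans e (sym fi≡f0))
    f≼h {suc x} {suc y} e = f≼g e
    h≼f : h ≼ f
    h≼f {zero} {zero} e = refl
    h≼f {zero} {suc y} e = trans (sym fi≡f0) (g≼f e)
    h≼f {suc x} {zero} e = trans (g≼f e) fi≡f0
    h≼f {suc x} {suc y} e = g≼f e
  ... | k , g , onto , f≼g , g≼f | no fi≢f0 = suc k , h , onto′ , f≼h , h≼f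
    where
    h : Fin (suc n) → Fin (suc k)
    h zero = zero
    h (suc j) = suc (g j)
    onto′ : Onto h
    onto′ zero = zero , refl
    onto′ (suc c) = let (x , e) = onto c in suc x , cong suc e
    f≼h : f ≼ h
    f≼h {zero} {zero} e = refl
    f≼h {zero} {suc y} e = contradiction (y , sym e) fi≢f0
    f≼h {suc x} {zero} e = contradiction (x , e) fi≢f0
    f≼h {suc x} {suc y} e = cong suc (f≼g e)
    h≼f : h ≼ f
    h≼f {zero} {zero} e = refl
    h≼f {suc x} {suc y} e = g≼f (Fin.suc-injective e)

-- Non-crossing partitions as labellings

NonCrossingLabel : (Fin n → A) → Set
NonCrossingLabel f = ∀ {a b c d} → a Fin.< b → b Fin.< c → c Fin.< d →
  f a ≡ f c → f b ≡ f d → f a ≡ f b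

module _ (_≟_ : DecidableEquality A) (f : Fin n → A) where

  class : Fin n → Subset n
  class x = tabulate λ y → does (f x ≟ f y)

  ∈-class⁺ : ∀ {x y} → f x ≡ f y → y ∈ class x
  ∈-class⁺ {x} {y} e = lookup⇒[]= y (class x)
    (trans (lookup∘tabulate _ y) (dec-true (f x ≟ f y) e))

  ∈-class⁻ : ∀ {x y} → y ∈ class x → f x ≡ f y
  ∈-class⁻ {x} {y} y∈ with f x ≟ f y | trans (sym (lookup∘tabulate (λ y → does (f x ≟ f y)) y)) ([]=⇒lookup y∈)
  ... | yes e | _ = e

  class-cong : ∀ {x y} → f x ≡ f y → class x ≡ class y
  class-cong e = ⊆-antisym
    (λ z∈ → ∈-class⁺ (trans (sym e) (∈-class⁻ z∈)))
    (λ z∈ → ∈-class⁺ (trans e (∈-class⁻ z∈)))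

  classPartition : Partition n
  classPartition = record
    { Block    = λ V → ∃[ x ] V ≡ class x
    ; nonempty = λ { (x , refl) → x , ∈-class⁺ refl }
    ; disjoint = λ { (x , refl) (y , refl) V≢W (z∈V , z∈W) →
        V≢W (class-cong (trans (∈-class⁻ z∈V) (sym (∈-class⁻ z∈W)))) }
    ; cover    = λ x → class x , (x , refl) , ∈-class⁺ refl
    }

  fromLabel : NonCrossingLabel f → NC n
  fromLabel nc = classPartition , λ { (x , refl) (y , refl) V≢W a<b b<c c<d ((a∈ , c∈) , (b∈ , d∈)) →
    let xa = ∈-class⁻ a∈ ; xc = ∈-class⁻ c∈ ; yb = ∈-class⁻ b∈ ; yd = ∈-class⁻ d∈ in
    V≢W (class-cong (trans xa (trans
      (nc a<b b<c c<d (trans (sym xa) xc) (trans (sym yb) yd)) (sym yb)))) }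

-- `Block` is a bare predicate, but equality of subsets is decidable; through the subset chosen by
-- `cover`, lying in one block becomes decidable.
blockOf : NC n → Fin n → Subset n
blockOf (π , _) x = proj₁ (Partition.cover π x)

∈-blockOf : (π : NC n) → ∀ {x y} → blockOf π x ≡ blockOf π y → y ∈ blockOf π x
∈-blockOf (π , _) {x} {y} e = subst (y ∈_) (sym e) (proj₂ (proj₂ (Partition.cover π y)))

blockOf-unique : (π : NC n) → ∀ {V x} → Partition.Block (proj₁ π) V → x ∈ V → V ≡ blockOf π x
blockOf-unique (π , _) {x = x} bV x∈V = let (_ , bW , x∈W) = Partition.cover π x in
  Partition.sameBlock π bV bW x∈V x∈W

_≟ˢ_ : DecidableEquality (Subset n)
_≟ˢ_ = ≡-dec _≟ᵇ_

-- The number of blocks. It changes by exactly one along an edge of the Hasse diagram and so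
-- measures height.
#_ : NC n → ℕ
# π = proj₁ (compress _≟ˢ_ (blockOf π))

lab : (π : NC n) → Fin n → Fin (# π)
lab π = proj₁ (proj₂ (compress _≟ˢ_ (blockOf π)))

lab-onto : (π : NC n) → Onto (lab π)
lab-onto π = proj₁ (proj₂ (proj₂ (compress _≟ˢ_ (blockOf π))))

block≼lab : (π : NC n) → blockOf π ≼ lab π
block≼lab π = proj₁ (proj₂ (proj₂ (proj₂ (compress _≟ˢ_ (blockOf π)))))

lab≼block : (π : NC n) → lab π ≼ blockOf π
lab≼block π = proj₂ (proj₂ (proj₂ (proj₂ (compress _≟ˢ_ (blockOf π)))))

lab-nonCrossing : (π : NC n) → NonCrossingLabel (lab π)
lab-nonCrossing Π@(π , nc) {a} {b} {c} {d} a<b b<c c<d ac bd =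
  block≼lab Π (decidable-stable (_ ≟ˢ _) λ V≢W →
    nc (proj₁ (proj₂ (Partition.cover π a))) (proj₁ (proj₂ (Partition.cover π b))) V≢W a<b b<c c<d
      ((proj₂ (proj₂ (Partition.cover π a)) , ∈-blockOf Π (lab≼block Π ac)) ,
       (proj₂ (proj₂ (Partition.cover π b)) , ∈-blockOf Π (lab≼block Π bd))))

⊑⇒≼ : (π ρ : NC n) → π ⊑ ρ → lab π ≼ lab ρ
⊑⇒≼ Π@(π , _) P π⊑ρ {x} {y} e = let
    (_ , bV , x∈V) = Partition.cover π x
    (_ , bW , V⊆W) = π⊑ρ bV
  in block≼lab P (trans (sym (blockOf-unique P bW (V⊆W x∈V)))
       (blockOf-unique P bW (V⊆W (∈-blockOf Π (lab≼block Π e)))))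

≼⇒⊑ : (π ρ : NC n) → lab π ≼ lab ρ → π ⊑ ρ
≼⇒⊑ Π@(π , _) P@(ρ , _) π≼ρ {V} bV = let (x , x∈V) = Partition.nonempty π bV in
  blockOf P x , proj₁ (proj₂ (Partition.cover ρ x)) , λ {y} y∈V →
    ∈-blockOf P (lab≼block P (π≼ρ (block≼lab Π
      (trans (sym (blockOf-unique Π bV x∈V)) (blockOf-unique Π bV y∈V)))))

module _ (_≟_ : DecidableEquality A) (f : Fin n → A) (nc : NonCrossingLabel f) where

  private
    Π = fromLabel _≟_ f nc

  lab-fromLabel⁺ : f ≼ lab Π
  lab-fromLabel⁺ e = block≼lab Π (class-cong _≟_ f e)

  lab-fromLabel⁻ : lab Π ≼ f
  lab-fromLabel⁻ e = ∈-class⁻ _≟_ f (∈-blockOf Π (lab≼block Π e))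

#-unique : (π : NC n) {f : Fin n → Fin k} → Onto f → f ≼ lab π → lab π ≼ f → # π ≡ k
#-unique π onto f≼π π≼f = ℕ.≤-antisym (onto-≤ (lab-onto π) f≼π) (onto-≤ onto π≼f)

-- Merging two classes along an uncrossed chord

module Merge (f : Fin n → Fin (suc k)) {x y : Fin n} (fx≢fy : f x ≢ f y) where

  -- The class of `x` takes over the label of `y`; the label `f x` is then free and is removed by
  -- `punchOut`.
  redirect : Fin (suc k) → Fin (suc k)
  redirect c with c Fin.≟ f x
  ... | yes _ = f y
  ... | no  _ = c

  redirect-avoids : ∀ c → f x ≢ redirect c
  redirect-avoids c with c Fin.≟ f x
  ... | yes _ = fx≢fy
  ... | no c≢ = c≢ ∘ sym

  redirect-hit : redirect (f x) ≡ f y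
  redirect-hit with f x Fin.≟ f x
  ... | yes _ = refl
  ... | no ≢ = contradiction refl ≢

  redirect-miss : ∀ {c} → f x ≢ c → redirect c ≡ c
  redirect-miss {c} ≢ with c Fin.≟ f x
  ... | yes e = contradiction (sym e) ≢
  ... | no _ = refl

  merged : Fin n → Fin k
  merged z = punchOut (redirect-avoids (f z))

  merged-onto : Onto f → Onto merged
  merged-onto onto c = let (z , e) = onto (punchIn (f x) c) in
    z , trans (Fin.punchOut-cong (f x) (trans (cong redirect e)
          (redirect-miss (Fin.punchInᵢ≢i (f x) c ∘ sym)))) (Fin.punchOut-punchIn (f x))

  f≼merged : f ≼ merged
  f≼merged e = Fin.punchOut-cong (f x) (cong redirect e)

  merged-x≡y : merged x ≡ merged y
  merged-x≡y = Fin.punchOut-cong (f x) (trans redirect-hit (sym (redirect-miss fx≢fy)))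

  OnChord : Fin n → Set
  OnChord z = f z ≡ f x ⊎ f z ≡ f y

  merged⁻ : ∀ {z w} → merged z ≡ merged w → f z ≡ f w ⊎ (OnChord z × OnChord w)
  merged⁻ {z} {w} e with f z Fin.≟ f x | f w Fin.≟ f x
    | Fin.punchOut-injective (redirect-avoids (f z)) (redirect-avoids (f w)) e
  ... | yes zx | yes wx | _  = inj₁ (trans zx (sym wx))
  ... | yes zx | no _   | yw = inj₂ (inj₁ zx , inj₂ (sym yw))
  ... | no _   | yes wx | zy = inj₂ (inj₂ zy , inj₁ wx)
  ... | no _   | no _   | zw = inj₁ zw

  merged-least : {g : Fin n → A} → f ≼ g → g x ≡ g y → merged ≼ g
  merged-least {g = g} f≼g gxy e with merged⁻ e
  ... | inj₁ zw = f≼g zw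
  ... | inj₂ (z , w) = trans (at z) (sym (at w))
    where
    at : ∀ {z} → OnChord z → g z ≡ g x
    at (inj₁ zx) = f≼g zx
    at (inj₂ zy) = trans (f≼g zy) (sym gxy)

  OnChord⇒merged : ∀ {z} → OnChord z → merged z ≡ merged x
  OnChord⇒merged (inj₁ zx) = f≼merged zx
  OnChord⇒merged (inj₂ zy) = trans (f≼merged zy) (sym merged-x≡y)

-- For `x < y`, these are the two ways in which a pair `b < d` from one class can interlace with `x`
-- and `y`.
Uncrossed : (Fin n → A) → Fin n → Fin n → Set
Uncrossed f x y = ∀ {b d} → f b ≡ f d →
  ¬ (b Fin.< x × x Fin.< d × d Fin.< y) × ¬ (x Fin.< b × b Fin.< y × y Fin.< d)

private
  module Sides (f : Fin n → A) (nc : NonCrossingLabel f) {u v} (fu≡fv : f u ≡ f v) where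

    Inside : Fin n → Set
    Inside z = u Fin.< z × z Fin.< v

    -- A class with one point under the chord from `u` to `v` and another point elsewhere would
    -- cross it, unless it is the class of `u`.
    inside-resp : ∀ {i j} → f i ≡ f j → f u ≢ f i → Inside i → Inside j
    inside-resp {i} {j} ij u≢i (u<i , i<v) = lower , upper
      where
      lower : u Fin.< j
      lower with Fin.<-cmp u j
      ... | tri< u<j _ _ = u<j
      ... | tri≈ _ refl _ = contradiction (sym ij) u≢i
      ... | tri> _ _ j<u = contradiction (sym (trans ij (nc j<u u<i i<v (sym ij) fu≡fv))) u≢i
      upper : j Fin.< v
      upper with Fin.<-cmp j v
      ... | tri< j<v _ _ = j<v
      ... | tri≈ _ refl _ = contradiction (trans fu≡fv (sym ij)) u≢i
      ... | tri> _ _ v<j = contradiction (nc u<i i<v v<j fu≡fv ij) u≢i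

module _ (f : Fin n → Fin (suc k)) {x y} (fx≢fy : f x ≢ f y) (nc : NonCrossingLabel f)
         (x<y : x Fin.< y) (un : Uncrossed f x y) where

  open Merge f fx≢fy

  private
    -- As `i` and `o` have different labels, one belongs to the class of `x` and the other to that
    -- of `y`. The chord from `u` to `v` keeps each class on one side, so it parts `x` from `y` and
    -- crosses their chord.
    separated : ∀ {u v i o} → (uv : f u ≡ f v) → Sides.Inside f nc uv i → ¬ Sides.Inside f nc uv o →
      OnChord i → OnChord o → f i ≢ f o → (∀ {z} → OnChord z → f u ≢ f z) → ⊥
    separated {u} {v} {i} {o} uv in-i out-o ci co i≢o off with ci | co
    ... | inj₁ ix | inj₁ ox = i≢o (trans ix (sym ox))
    ... | inj₂ iy | inj₂ oy = i≢o (trans iy (sym oy))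
    ... | inj₁ ix | inj₂ oy = case Fin.<-cmp y v of λ
        { (tri< y<v _ _) → out-o (S.inside-resp (sym oy) (off (inj₂ refl)) (<-trans (proj₁ in-x) x<y , y<v))
        ; (tri≈ _ refl _) → off (inj₂ refl) uv
        ; (tri> _ _ v<y) → proj₁ (un uv) (proj₁ in-x , proj₂ in-x , v<y) }
      where
      module S = Sides f nc uv
      in-x = S.inside-resp ix (off ci) in-i
    ... | inj₂ iy | inj₁ ox = case Fin.<-cmp u x of λ
        { (tri< u<x _ _) → out-o (S.inside-resp (sym ox) (off (inj₁ refl)) (u<x , <-trans x<y (proj₂ in-y)))
        ; (tri≈ _ refl _) → off (inj₁ refl) refl
        ; (tri> _ _ x<u) → proj₂ (un uv) (x<u , proj₁ in-y , proj₂ in-y) }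
      where
      module S = Sides f nc uv
      in-y = S.inside-resp iy (off ci) in-i

  -- x and y lie on the same side of each chord of a third block, hence so do all points
  -- of the blocks of x and y.
  merged-nonCrossing : NonCrossingLabel merged
  merged-nonCrossing {a} {b} {c} {d} a<b b<c c<d ac bd =
    decidable-stable (merged a Fin.≟ merged b) λ a≢b → refute a≢b (merged⁻ ac) (merged⁻ bd)
    where
    refute : merged a ≢ merged b →
      f a ≡ f c ⊎ (OnChord a × OnChord c) → f b ≡ f d ⊎ (OnChord b × OnChord d) → ⊥
    refute a≢b (inj₁ fac) (inj₁ fbd) = a≢b (f≼merged (nc a<b b<c c<d fac fbd))
    refute a≢b (inj₂ (ca , _)) (inj₂ (cb , _)) =
      a≢b (trans (OnChord⇒merged ca) (sym (OnChord⇒merged cb)))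
    refute a≢b (inj₁ fac) (inj₂ (cb , cd)) with f b Fin.≟ f d
    ... | yes fbd = a≢b (f≼merged (nc a<b b<c c<d fac fbd))
    ... | no fb≢fd = separated fac (a<b , b<c) (λ (_ , d<c) → ℕ.<-asym c<d d<c) cb cd fb≢fd
          λ cz az → a≢b (trans (f≼merged az) (trans (OnChord⇒merged cz) (sym (OnChord⇒merged cb))))
    refute a≢b (inj₂ (ca , cc)) (inj₁ fbd) with f a Fin.≟ f c
    ... | yes fac = a≢b (f≼merged (nc a<b b<c c<d fac fbd))
    ... | no fa≢fc = separated fbd (b<c , c<d) (λ (b<a , _) → ℕ.<-asym a<b b<a) cc ca (fa≢fc ∘ sym)
          λ cz bz → a≢b (trans (OnChord⇒merged ca) (sym (trans (f≼merged bz) (OnChord⇒merged cz))))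

-- A pair that has to be merged on the way from `g` to `h`. The two points are neighbours within
-- their `h`-class, which is what keeps the chord between them uncrossed.
record Closest {n : ℕ} {A B : Set} (g : Fin n → A) (h : Fin n → B) : Set where
  field
    {x y} : Fin n
    x<y   : x Fin.< y
    gx≢gy : g x ≢ g y
    hx≡hy : h x ≡ h y
    gap   : ∀ {w} → x Fin.< w → w Fin.< y → h w ≢ h x

module _ (_≟ᴬ_ : DecidableEquality A) (_≟ᴮ_ : DecidableEquality B) (g : Fin n → A) (h : Fin n → B) where

  private
    Bad : Fin n → Fin n → Set
    Bad x y = g x ≢ g y × h x ≡ h y

    closest-below : ∀ bound {x y} → toℕ y ≤ bound + toℕ x → x Fin.< y → Bad x y → Closest g h
    closest-below zero y≤x x<y _ = contradiction (ℕ.<-≤-trans x<y y≤x) (<-irrefl refl)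
    closest-below (suc bound) {x} {y} y≤ x<y (g≢ , h≡)
      with Fin.any? (λ w → (x Fin.<? w) ×-dec (w Fin.<? y) ×-dec (h w ≟ᴮ h x))
    ... | no none = record { x<y = x<y ; gx≢gy = g≢ ; hx≡hy = h≡ ; gap = λ xw wy e → none (_ , xw , wy , e) }
    ... | yes (w , x<w , w<y , hw) with g x ≟ᴬ g w
    ...   | no gx≢gw = closest-below bound (ℕ.≤-pred (≤-trans w<y y≤)) x<w (gx≢gw , sym hw)
    -- Here `w` and `y` are apart in `g`, since `x` and `y` are.
    ...   | yes gx≡gw = closest-below bound
              (≤-trans y≤ (≤-trans (ℕ.≤-reflexive (sym (ℕ.+-suc bound (toℕ x)))) (ℕ.+-monoʳ-≤ bound x<w)))
              w<y (g≢ ∘ trans gx≡gw , trans hw h≡)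

  closest : (∃[ x ] ∃[ y ] g x ≢ g y × h x ≡ h y) → Closest g h
  closest (x , y , g≢ , h≡) with Fin.<-cmp x y
  ... | tri< x<y _ _ = closest-below (toℕ y) (ℕ.m≤m+n (toℕ y) (toℕ x)) x<y (g≢ , h≡)
  ... | tri≈ _ refl _ = contradiction refl g≢
  ... | tri> _ _ y<x = closest-below (toℕ x) (ℕ.m≤m+n (toℕ x) (toℕ y)) y<x (g≢ ∘ sym , sym h≡)

  ≼-or-closest : h ≼ g ⊎ Closest g h
  ≼-or-closest with Fin.any? (λ x → Fin.any? λ y → ¬? (g x ≟ᴬ g y) ×-dec (h x ≟ᴮ h y))
  ... | yes bad = inj₂ (closest bad)
  ... | no good = inj₁ λ {x} {y} e → decidable-stable (g x ≟ᴬ g y) λ g≢ → good (x , y , g≢ , e)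

-- A crossing pair of `g` is also a pair of `h`, and `h` is non-crossing, so it would lie in the
-- `h`-class of `x`; but one of its points is strictly between `x` and `y`.
closest-uncrossed : (g : Fin n → A) (h : Fin n → B) → NonCrossingLabel h → g ≼ h →
  (c : Closest g h) → Uncrossed g (Closest.x c) (Closest.y c)
closest-uncrossed g h nc g≼h c bd =
    (λ (b<x , x<d , d<y) → gap x<d d<y (trans (sym (g≼h bd)) (nc b<x x<d d<y (g≼h bd) hx≡hy)))
  , (λ (x<b , b<y , y<d) → gap x<b b<y (sym (nc x<b b<y y<d hx≡hy (g≼h bd))))
  where open Closest c

-- In `least` the labelling `g` may have crossings: the merge is the least coarsening among all
-- partitions, not only among the non-crossing ones.
record Merging {n : ℕ} (π : NC n) {x y : Fin n} : Set₁ where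
  field
    target : NC n
    π≼     : lab π ≼ lab target
    joins  : lab target x ≡ lab target y
    least  : ∀ {A : Set} {g : Fin n → A} → lab π ≼ g → g x ≡ g y → lab target ≼ g
    count  : # π ≡ suc (# target)

merging : (π : NC n) {x y : Fin n} → x Fin.< y → lab π x ≢ lab π y → Uncrossed (lab π) x y →
  Merging π {x} {y}
merging {n} π {x} {y} x<y x≢y un = go (lab π) (lab-onto π) (lab-nonCrossing π) x≢y un
    id id refl
  where
  -- Stated for every labelling with the kernel of `lab π`, so that the number of classes can be
  -- matched as a successor.
  go : ∀ {k} (f : Fin n → Fin k) → Onto f → NonCrossingLabel f → f x ≢ f y → Uncrossed f x y →
    f ≼ lab π → lab π ≼ f → # π ≡ k → Merging π {x} {y}
  go {zero} f _ _ _ _ _ _ _ with () ← f x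
  go {suc k} f onto nc fx≢fy un f≼π π≼f eq = record
    { target = target
    ; π≼ = λ e → M→ (f≼merged (π≼f e))
    ; joins = M→ merged-x≡y
    ; least = λ π≼g gxy e → merged-least (λ e → π≼g (f≼π e)) gxy (M← e)
    ; count = trans eq (cong suc (sym (#-unique target (merged-onto onto) M→ M←)))
    }
    where
    open Merge f fx≢fy
    mnc = merged-nonCrossing f fx≢fy nc x<y un
    target = fromLabel Fin._≟_ merged mnc
    M→ = lab-fromLabel⁺ Fin._≟_ merged mnc
    M← = lab-fromLabel⁻ Fin._≟_ merged mnc

-- Walks in the Hasse diagram

#-antitone : (π ρ : NC n) → lab π ≼ lab ρ → # ρ ≤ # π
#-antitone π ρ π≼ρ = onto-≤ (lab-onto ρ) π≼ρ

record MergeBelow {n : ℕ} (π ρ : NC n) : Set₁ where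
  field
    {x y}   : Fin n
    x≢y     : lab π x ≢ lab π y
    ρx≡ρy   : lab ρ x ≡ lab ρ y
    merger  : Merging π {x} {y}
  open Merging merger public
  target≼ρ : lab π ≼ lab ρ → lab target ≼ lab ρ
  target≼ρ π≼ρ = least π≼ρ ρx≡ρy

-- From a partition strictly below `ρ` one can move up by merging just two blocks without leaving
-- the interval below `ρ`. Covers and saturated chains both come from this.
≽-or-mergeBelow : (π ρ : NC n) → lab π ≼ lab ρ → lab ρ ≼ lab π ⊎ MergeBelow π ρ
≽-or-mergeBelow π ρ π≼ρ with ≼-or-closest Fin._≟_ Fin._≟_ (lab π) (lab ρ)
... | inj₁ ρ≼π = inj₁ ρ≼π
... | inj₂ c = inj₂ (record { x≢y = gx≢gy ; ρx≡ρy = hx≡hy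
  ; merger = merging π x<y gx≢gy (closest-uncrossed (lab π) (lab ρ) (lab-nonCrossing ρ) π≼ρ c) })
  where open Closest c

module _ {n : ℕ} where

  private
    module P = Poset (NC-poset n)
    module PP = PosetProperties (NC-poset n)
  open HasseDiagram (NC-poset n)

  ≼-antisym : (π ρ : NC n) → lab π ≼ lab ρ → lab ρ ≼ lab π → π ≈ ρ
  ≼-antisym π ρ π≼ρ ρ≼π = P.antisym {π} {ρ} (≼⇒⊑ π ρ π≼ρ) (≼⇒⊑ ρ π ρ≼π)

  ≈⇒≼ : (π ρ : NC n) → π ≈ ρ → lab π ≼ lab ρ
  ≈⇒≼ π ρ π≈ρ = ⊑⇒≼ π ρ (P.reflexive {π} {ρ} π≈ρ)

  #-strict : (π ρ : NC n) → π PP.< ρ → # ρ < # π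
  #-strict π ρ (π⊑ρ , π≉ρ) with ≽-or-mergeBelow π ρ (⊑⇒≼ π ρ π⊑ρ)
  ... | inj₁ ρ≼π = contradiction (≼-antisym π ρ (⊑⇒≼ π ρ π⊑ρ) ρ≼π) π≉ρ
  ... | inj₂ b = ℕ.≤-<-trans (#-antitone target ρ (target≼ρ (⊑⇒≼ π ρ π⊑ρ)))
                   (subst (# target <_) (sym count) (ℕ.n<1+n _))
    where open MergeBelow b

  target-< : (π ρ : NC n) (b : MergeBelow π ρ) → π PP.< MergeBelow.target b
  target-< π ρ b = ≼⇒⊑ π target π≼ , λ π≈t → x≢y (≈⇒≼ target π (P.Eq.sym {π} {target} π≈t) joins)
    where open MergeBelow b

  -- A partition strictly in between would have a block count strictly between two consecutive
  -- numbers.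
  target-covers : (π ρ : NC n) (b : MergeBelow π ρ) → π CoveredBy MergeBelow.target b
  target-covers π ρ b = target-< π ρ b , λ (σ , π<σ , σ<t) →
    ℕ.<⇒≱ (#-strict π σ π<σ) (subst (_≤ # σ) (sym count) (#-strict σ target σ<t))
    where open MergeBelow b

  -- The merge found inside `ρ` cannot be strictly below `ρ`, or it would refute the covering.
  covering-merges : (π ρ : NC n) → π CoveredBy ρ →
    Σ (MergeBelow π ρ) λ b → lab ρ ≼ lab (MergeBelow.target b)
  covering-merges π ρ ((π⊑ρ , π≉ρ) , tight) with ≽-or-mergeBelow π ρ (⊑⇒≼ π ρ π⊑ρ)
  ... | inj₁ ρ≼π = contradiction (≼-antisym π ρ (⊑⇒≼ π ρ π⊑ρ) ρ≼π) π≉ρ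
  ... | inj₂ b = b , ρ≼t
    where
    open MergeBelow b
    t≼ρ = target≼ρ (⊑⇒≼ π ρ π⊑ρ)
    ρ≼t : lab ρ ≼ lab target
    ρ≼t e = decidable-stable (_ Fin.≟ _) λ t≢ → tight (target , target-< π ρ b ,
      (≼⇒⊑ target ρ t≼ρ , λ t≈ρ → t≢ (≈⇒≼ ρ target (P.Eq.sym {target} {ρ} t≈ρ) e)))

  CoveredBy-respˡ : (π π′ ρ : NC n) → π ≈ π′ → π′ CoveredBy ρ → π CoveredBy ρ
  CoveredBy-respˡ π π′ ρ π≈π′ (π′<ρ , tight) = PP.<-respˡ-≈ {ρ} {π′} {π} (P.Eq.sym {π} {π′} π≈π′) π′<ρ ,
    λ (σ , π<σ , σ<ρ) → tight (σ , PP.<-respˡ-≈ {σ} {π} {π′} π≈π′ π<σ , σ<ρ)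

  CoveredBy-respʳ : (π ρ ρ′ : NC n) → ρ ≈ ρ′ → π CoveredBy ρ′ → π CoveredBy ρ
  CoveredBy-respʳ π ρ ρ′ ρ≈ρ′ (π<ρ′ , tight) = PP.<-respʳ-≈ {π} {ρ′} {ρ} (P.Eq.sym {ρ} {ρ′} ρ≈ρ′) π<ρ′ ,
    λ (σ , π<σ , σ<ρ) → tight (σ , π<σ , PP.<-respʳ-≈ {σ} {ρ} {ρ′} ρ≈ρ′ σ<ρ)

  walk-++ : ∀ {i j} {π ρ σ : NC n} → Walk i π ρ → Walk j ρ σ → Walk (i + j) π σ
  walk-++ {π = π} {ρ} {σ} (stop π≈ρ) w = resp w
    where
    resp : ∀ {j} → Walk j ρ σ → Walk j π σ
    resp (stop ρ≈σ) = stop (P.Eq.trans {π} {ρ} {σ} π≈ρ ρ≈σ)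
    resp (step {y = τ} (inj₁ c) w) = step (inj₁ (CoveredBy-respˡ π ρ τ π≈ρ c)) w
    resp (step {y = τ} (inj₂ c) w) = step (inj₂ (CoveredBy-respʳ τ π ρ π≈ρ c)) w
  walk-++ (step a v) w = step a (walk-++ v w)

  ascend : ∀ d (π ρ : NC n) → lab π ≼ lab ρ → # π ≡ d + # ρ → Walk d π ρ
  ascend d π ρ π≼ρ eq with d | eq | ≽-or-mergeBelow π ρ π≼ρ
  ... | zero  | eq | inj₁ ρ≼π = stop (≼-antisym π ρ π≼ρ ρ≼π)
  ... | zero  | eq | inj₂ b = contradiction (#-antitone target ρ (target≼ρ π≼ρ))
          (ℕ.<⇒≱ (ℕ.≤-reflexive (trans (sym count) eq)))
    where open MergeBelow b
  ... | suc d | eq | inj₁ ρ≼π = contradiction (subst (_≤ # ρ) eq (#-antitone ρ π ρ≼π))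
          (ℕ.m+1+n≰m _ ∘ subst (_≤ # ρ) (ℕ.+-comm (suc d) (# ρ)))
  ... | suc d | eq | inj₂ b = step {y = target} (inj₁ (target-covers π ρ b))
          (ascend d target ρ (target≼ρ π≼ρ) (ℕ.suc-injective (trans (sym count) eq)))
    where open MergeBelow b

  walk-reverse : ∀ {k} {π ρ : NC n} → Walk k π ρ → Walk k ρ π
  walk-reverse {π = π} {ρ} (stop π≈ρ) = stop (P.Eq.sym {π} {ρ} π≈ρ)
  walk-reverse {suc k} {π} {ρ} (step {y = σ} a w) = subst (λ i → Walk i ρ π) (ℕ.+-comm k 1)
    (walk-++ (walk-reverse w) (step {y = π} (flip {π} {σ} a) (stop (P.Eq.refl {π}))))
    where
    flip : ∀ {π σ} → Adjacent π σ → Adjacent σ π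
    flip (inj₁ c) = inj₂ c
    flip (inj₂ c) = inj₁ c

  walk-via-lower : (σ π ρ : NC n) → lab σ ≼ lab π → lab σ ≼ lab ρ →
    Walk ((# σ ∸ # π) + (# σ ∸ # ρ)) π ρ
  walk-via-lower σ π ρ σ≼π σ≼ρ = walk-++
    (walk-reverse (ascend _ σ π σ≼π (sym (ℕ.m∸n+n≡m (#-antitone σ π σ≼π)))))
    (ascend _ σ ρ σ≼ρ (sym (ℕ.m∸n+n≡m (#-antitone σ ρ σ≼ρ))))

  walk-via-upper : (σ π ρ : NC n) → lab π ≼ lab σ → lab ρ ≼ lab σ →
    Walk ((# π ∸ # σ) + (# ρ ∸ # σ)) π ρ
  walk-via-upper σ π ρ π≼σ ρ≼σ = walk-++
    (ascend _ π σ π≼σ (sym (ℕ.m∸n+n≡m (#-antitone π σ π≼σ))))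
    (walk-reverse (ascend _ ρ σ ρ≼σ (sym (ℕ.m∸n+n≡m (#-antitone ρ σ ρ≼σ)))))

  -- Q′ arises from Q by repeating the merges of the up-steps of a walk from π to ρ, each
  -- of which loses at most one class.
  record Balance (k : ℕ) (π ρ : NC n) {q} (Q : Fin n → Fin q) : Set where
    field
      {ups downs q′} : ℕ
      length≡  : k ≡ ups + downs
      balance  : # π + downs ≡ # ρ + ups
      Q′       : Fin n → Fin q′
      Q′-onto  : Onto Q′
      Q≼Q′     : Q ≼ Q′
      ρ≼Q′     : lab ρ ≼ Q′
      drop     : q ≤ q′ + ups

  -- The invariant is that `Q` is coarser than the current vertex. An up-step merges some `x` and
  -- `y`, and `Q` has to merge them too if it does not identify them yet.
  walk-balance : ∀ {k} {π ρ : NC n} → Walk k π ρ → ∀ {q} (Q : Fin n → Fin q) → Onto Q → lab π ≼ Q →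
    Balance k π ρ Q
  walk-balance {π = π} {ρ} (stop π≈ρ) {q} Q onto π≼Q = record
    { length≡ = refl
    ; balance = cong (_+ 0) (ℕ.≤-antisym (#-antitone ρ π ρ≼π) (#-antitone π ρ (≈⇒≼ π ρ π≈ρ)))
    ; Q′-onto = onto ; Q≼Q′ = id
    ; ρ≼Q′ = λ e → π≼Q (ρ≼π e) ; drop = ℕ.m≤m+n q 0 }
    where ρ≼π = ≈⇒≼ ρ π (P.Eq.sym {π} {ρ} π≈ρ)
  -- On a down-step `Q` can stay as it is, being coarser than the finer `σ` as well.
  walk-balance {π = π} {ρ} (step {y = σ} (inj₂ c) w) Q onto π≼Q = record
    { length≡ = trans (cong suc length≡) (sym (ℕ.+-suc ups downs))
    ; balance = trans (ℕ.+-suc (# π) downs) (trans (cong (_+ downs) (sym #σ≡)) balance)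
    ; Q′-onto = Q′-onto ; Q≼Q′ = Q≼Q′ ; ρ≼Q′ = ρ≼Q′ ; drop = drop }
    where
    cm = covering-merges σ π c
    open MergeBelow (proj₁ cm) using (target; target≼ρ; count)
    #σ≡ : # σ ≡ suc (# π)
    #σ≡ = trans count (cong suc (ℕ.≤-antisym (#-antitone π target (proj₂ cm))
      (#-antitone target π (target≼ρ (⊑⇒≼ σ π (proj₁ (proj₁ c)))))))
    open Balance (walk-balance w Q onto (λ e → π≼Q (⊑⇒≼ σ π (proj₁ (proj₁ c)) e)))
  walk-balance {π = π} {ρ} (step {y = σ} (inj₁ c) w) {q} Q onto π≼Q = go q Q onto π≼Q (Q x Fin.≟ Q y)
    where
    cm = covering-merges π σ c
    open MergeBelow (proj₁ cm)
    #π≡ : # π ≡ suc (# σ)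
    #π≡ = trans count (cong suc (ℕ.≤-antisym
      (#-antitone σ target (proj₂ cm))
      (#-antitone target σ (target≼ρ (⊑⇒≼ π σ (proj₁ (proj₁ c)))))))
    finish : ∀ {q} (Q : Fin n → Fin q) {q₁} (Q₁ : Fin n → Fin q₁) → lab π ≼ Q → Onto Q₁ → Q ≼ Q₁ →
      Q₁ x ≡ Q₁ y → q ≤ suc q₁ → Balance _ π ρ Q
    finish Q Q₁ π≼Q onto₁ Q≼Q₁ e q≤ = record
      { length≡ = cong suc length≡
      ; balance = trans (cong (_+ downs) #π≡) (trans (cong suc balance) (sym (ℕ.+-suc (# ρ) ups)))
      ; Q′-onto = Q′-onto
      ; Q≼Q′ = λ e → Q≼Q′ (Q≼Q₁ e)
      ; ρ≼Q′ = ρ≼Q′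
      ; drop = ≤-trans q≤ (≤-trans (s≤s drop) (ℕ.≤-reflexive (sym (ℕ.+-suc q′ ups)))) }
      where open Balance (walk-balance w Q₁ onto₁ (λ s → least (λ p → Q≼Q₁ (π≼Q p)) e (proj₂ cm s)))
    go : ∀ q (Q : Fin n → Fin q) → Onto Q → lab π ≼ Q → Dec (Q x ≡ Q y) → Balance _ π ρ Q
    go q Q onto π≼Q (yes Qx≡Qy) = finish Q Q π≼Q onto id Qx≡Qy (ℕ.n≤1+n q)
    go zero Q onto π≼Q (no _) with () ← Q x
    go (suc q) Q onto π≼Q (no Qx≢Qy) = finish Q merged π≼Q (merged-onto onto) f≼merged merged-x≡y ≤-refl
      where open Merge Q Qx≢Qy

private
  id-nonCrossing : NonCrossingLabel (id {A = Fin n})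
  id-nonCrossing a<b b<c _ a≡c _ = contradiction (<-trans a<b b<c) (ℕ.<-irrefl (cong toℕ a≡c))

  const₀ : Fin n → Fin 1
  const₀ _ = zero

  const₀-nonCrossing : NonCrossingLabel (const₀ {n})
  const₀-nonCrossing _ _ _ _ _ = refl

finest coarsest : ∀ n → NC n
finest n = fromLabel Fin._≟_ id id-nonCrossing
coarsest n = fromLabel Fin._≟_ const₀ const₀-nonCrossing

finest≼ : (g : Fin n → A) → lab (finest n) ≼ g
finest≼ g e = cong g (lab-fromLabel⁻ Fin._≟_ id id-nonCrossing e)

≼coarsest : (g : Fin n → A) → g ≼ lab (coarsest n)
≼coarsest g e = lab-fromLabel⁺ Fin._≟_ const₀ const₀-nonCrossing refl

#-finest : ∀ n → # finest n ≡ n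
#-finest n = #-unique (finest n) (λ c → c , refl) (cong (lab (finest n))) (finest≼ id)

#-coarsest : ∀ n → # coarsest (suc n) ≡ 1
#-coarsest n = #-unique (coarsest (suc n)) (λ { zero → zero , refl })
  (≼coarsest const₀) (λ _ → refl)

-- With a second class, the indicator of class `zero` would be a non-constant colouring.
two-classes : (f : Fin n → Fin k) → Onto f → (∀ (χ : Fin n → Bool) → f ≼ χ → ∀ x y → χ x ≡ χ y) → k ≤ 1
two-classes {k = zero} f onto const = z≤n
two-classes {k = suc zero} f onto const = ≤-refl
two-classes {k = suc (suc k)} f onto const = contradiction
  (trans (sym (dec-true (f (x₀) Fin.≟ zero) (proj₂ (onto zero))))
    (trans (const χ (λ e → cong (λ c → does (c Fin.≟ zero)) e) x₀ x₁)
      (cong (λ c → does (c Fin.≟ zero)) (proj₂ (onto (suc zero)))))) λ ()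
  where
  χ = λ z → does (f z Fin.≟ zero)
  x₀ = proj₁ (onto zero)
  x₁ = proj₁ (onto (suc zero))

one-class : k ≤ 1 → (c d : Fin k) → c ≡ d
one-class {suc zero} _ zero zero = refl
one-class {suc (suc k)} (s≤s ()) _ _

-- Partners of a partition into convex blocks: block count and connectedness

module Partner {n : ℕ} (Λ : NC (suc n))
  (convex : ∀ {x w y} → x Fin.< w → w Fin.< y → lab Λ x ≡ lab Λ y → lab Λ w ≡ lab Λ x) where

  open HasseDiagram (NC-poset (suc n))

  -- Connectedness of the graph with the blocks of both partitions as vertices and the points as
  -- edges, expressed by two-colourings so that no paths have to be handled.
  Connected : NC (suc n) → Set
  Connected ρ = ∀ (χ : Fin (suc n) → Bool) → lab Λ ≼ χ → lab ρ ≼ χ → ∀ x y → χ x ≡ χ y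

  private
    -- Points of an interval next to each other can be merged without a crossing, which
    -- gives an upper bound of Λ and ρ that still respects χ.
    upperBound : ∀ bound (ρ : NC (suc n)) (χ : Fin (suc n) → Bool) → # ρ ≤ bound →
      lab Λ ≼ χ → lab ρ ≼ χ → Σ (NC (suc n)) λ σ → lab Λ ≼ lab σ × lab ρ ≼ lab σ × lab σ ≼ χ
    upperBound bound ρ χ _ Λ≼χ ρ≼χ with ≼-or-closest Fin._≟_ Fin._≟_ (lab ρ) (lab Λ)
    ... | inj₁ Λ≼ρ = ρ , Λ≼ρ , id , ρ≼χ
    upperBound zero ρ χ ρ≤0 _ _ | inj₂ c with () ← subst Fin (ℕ.n≤0⇒n≡0 ρ≤0) (lab ρ zero)
    upperBound (suc bound) ρ χ ρ≤ Λ≼χ ρ≼χ | inj₂ c =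
      let (σ , Λ≼σ , t≼σ , σ≼χ) = upperBound bound target χ (ℕ.≤-pred (subst (_≤ suc bound) count ρ≤))
            Λ≼χ (least ρ≼χ (Λ≼χ hx≡hy))
      in σ , Λ≼σ , (λ e → t≼σ (π≼ e)) , σ≼χ
      where
      open Closest c
      adjacent : Uncrossed (lab ρ) x y
      adjacent _ = (λ (_ , x<d , d<y) → gap x<d d<y (convex x<d d<y hx≡hy))
                 , (λ (x<b , b<y , _) → gap x<b b<y (convex x<b b<y hx≡hy))
      open Merging (merging ρ x<y gx≢gy adjacent)

    ∸-gap : ∀ {L R c d} → c ≤ L → d ≤ R → n ≤ (L ∸ c) + (R ∸ d) → n + (c + d) ≤ L + R
    ∸-gap {L} {R} {c} {d} c≤L d≤R h = ≤-trans (ℕ.+-monoˡ-≤ (c + d) h) (ℕ.≤-reflexive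
      (trans (interchange (L ∸ c) (R ∸ d) c d) (cong₂ _+_ (ℕ.m∸n+n≡m c≤L) (ℕ.m∸n+n≡m d≤R))))
      where
      interchange : ∀ a b c d → (a + b) + (c + d) ≡ (a + c) + (b + d)
      interchange = solve-∀

    #≤ : (π : NC (suc n)) → # π ≤ suc n
    #≤ π = subst (# π ≤_) (#-finest (suc n)) (#-antitone (finest (suc n)) π (finest≼ (lab π)))
    1≤# : (π : NC (suc n)) → 1 ≤ # π
    1≤# π = subst (_≤ # π) (#-coarsest n) (#-antitone π (coarsest (suc n)) (≼coarsest (lab π)))

  -- Through the finest partition the walk has length `2(n + 1)` minus `# Λ + # ρ`, through the
  -- coarsest `# Λ + # ρ` minus 2. These lengths add up to `2n` and neither is below `n`, so both
  -- equal `n`.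
  partner⇒ : (ρ : NC (suc n)) → MeandricPartner Λ ρ → # Λ + # ρ ≡ suc (suc n) × Connected ρ
  partner⇒ ρ (_ , shortest) = ℕ.≤-antisym count≤ count≥ , connected
    where
    below : n ≤ (suc n ∸ # Λ) + (suc n ∸ # ρ)
    below = subst (λ k → n ≤ (k ∸ # Λ) + (k ∸ # ρ)) (#-finest (suc n))
      (shortest _ (walk-via-lower (finest (suc n)) Λ ρ (finest≼ (lab Λ)) (finest≼ (lab ρ))))
    above : n ≤ (# Λ ∸ 1) + (# ρ ∸ 1)
    above = subst (λ k → n ≤ (# Λ ∸ k) + (# ρ ∸ k)) (#-coarsest n)
      (shortest _ (walk-via-upper (coarsest (suc n)) Λ ρ (≼coarsest (lab Λ)) (≼coarsest (lab ρ))))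
    count≤ : # Λ + # ρ ≤ suc (suc n)
    count≤ = ℕ.+-cancelˡ-≤ n _ _ (≤-trans (∸-gap (#≤ Λ) (#≤ ρ) below)
      (ℕ.≤-reflexive (sym (ℕ.+-suc n (suc n)))))
    count≥ : suc (suc n) ≤ # Λ + # ρ
    count≥ = ≤-trans (ℕ.≤-reflexive (ℕ.+-comm 2 n)) (∸-gap (1≤# Λ) (1≤# ρ) above)
    connected : Connected ρ
    connected χ Λ≼χ ρ≼χ x y = let (σ , Λ≼σ , ρ≼σ , σ≼χ) = upperBound _ ρ χ ≤-refl Λ≼χ ρ≼χ in
      σ≼χ (one-class (small (# σ) (#-antitone Λ σ Λ≼σ) (#-antitone ρ σ ρ≼σ)
        (shortest _ (walk-via-upper σ Λ ρ Λ≼σ ρ≼σ))) _ _)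
      where
      -- With `c` blocks in the upper bound the walk through it has length `# Λ + # ρ` minus `2c`,
      -- that is `n + 2` minus `2c`; this is at least `n` only for `c ≤ 1`.
      small : ∀ c → c ≤ # Λ → c ≤ # ρ → n ≤ (# Λ ∸ c) + (# ρ ∸ c) → c ≤ 1
      small c c≤Λ c≤ρ via = half c (ℕ.+-cancelˡ-≤ n (c + c) 2
        (≤-trans (∸-gap c≤Λ c≤ρ via) (≤-trans count≤ (ℕ.≤-reflexive (ℕ.+-comm 2 n)))))
        where
        half : ∀ c → c + c ≤ 2 → c ≤ 1
        half zero _ = z≤n
        half (suc zero) _ = ≤-refl
        half (suc (suc c)) (s≤s (s≤s h)) with () ← subst (_≤ 0) (ℕ.+-suc c (suc c)) h

  -- The walk through the coarsest partition has length `n`. Along any walk the classes of `Λ` are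
  -- pushed to a labelling coarser than `Λ` and `ρ`, hence with one class; so at least `# Λ` minus 1
  -- steps go up, and the balance gives at least `# ρ` minus 1 steps down.
  ⇒partner : (ρ : NC (suc n)) → # Λ + # ρ ≡ suc (suc n) → Connected ρ → MeandricPartner Λ ρ
  ⇒partner ρ count connected = subst (λ k → Walk k Λ ρ) len
      (walk-via-upper (coarsest (suc n)) Λ ρ (≼coarsest (lab Λ)) (≼coarsest (lab ρ)))
    , λ j w → longer w
    where
    len : (# Λ ∸ # coarsest (suc n)) + (# ρ ∸ # coarsest (suc n)) ≡ n
    len = trans (cong (λ k → (# Λ ∸ k) + (# ρ ∸ k)) (#-coarsest n)) (pred₂ (1≤# Λ) (1≤# ρ) count)
      where
      pred₂ : ∀ {L R} → 1 ≤ L → 1 ≤ R → L + R ≡ suc (suc n) → (L ∸ 1) + (R ∸ 1) ≡ n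
      pred₂ {suc L} {suc R} _ _ e = ℕ.suc-injective (trans (sym (ℕ.+-suc L R)) (ℕ.suc-injective e))
    longer : ∀ {j} → Walk j Λ ρ → n ≤ j
    longer w = ℕ.≤-pred (ℕ.≤-pred (begin
      suc (suc n)            ≡⟨ count ⟨
      # Λ + # ρ              ≤⟨ ℕ.+-mono-≤ Λ≤ ρ≤ ⟩
      suc ups + suc downs    ≡⟨ cong suc (ℕ.+-suc ups downs) ⟩
      suc (suc (ups + downs)) ≡⟨ cong (λ i → suc (suc i)) length≡ ⟨
      suc (suc _)            ∎))
      where
      open ℕ.≤-Reasoning
      open Balance (walk-balance w (lab Λ) (lab-onto Λ) id)
      Λ≤ : # Λ ≤ suc ups
      Λ≤ = ≤-trans drop (ℕ.+-monoˡ-≤ ups (two-classes Q′ Q′-onto λ χ Q′≼χ →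
        connected χ (λ e → Q′≼χ (Q≼Q′ e)) (λ e → Q′≼χ (ρ≼Q′ e))))
      ρ≤ : # ρ ≤ suc downs
      ρ≤ = ℕ.+-cancelʳ-≤ ups (# ρ) (suc downs) (≤-trans (ℕ.≤-reflexive (sym balance))
        (≤-trans (ℕ.+-monoˡ-≤ downs Λ≤) (ℕ.≤-reflexive (cong suc (ℕ.+-comm ups downs)))))

-- Cutting a non-crossing labelling at its first point

NonCrossingBelow : ℕ → (ℕ → A) → Set
NonCrossingBelow N f = ∀ {a b c d} → a < b → b < c → c < d → d < N →
  f a ≡ f c → f b ≡ f d → f a ≡ f b

-- Equality of kernels on the points below `N`. Labellings are functions on all of `ℕ` from here on,
-- so that shifts and rotations are plain arithmetic without casts between `Fin` types.
infix 4 _≐[_]_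
_≐[_]_ : (ℕ → ℕ) → ℕ → (ℕ → ℕ) → Set
f ≐[ N ] g = ∀ {i j} → i < N → j < N → (f i ≡ f j → g i ≡ g j) × (g i ≡ g j → f i ≡ f j)

-- Certifies that `f` has exactly `k` classes on the points below `N`.
record Classes (N k : ℕ) (f : ℕ → ℕ) : Set where
  field
    name    : ℕ → ℕ
    name<   : ∀ {i} → i < N → name i < k
    onto    : ∀ {c} → c < k → ∃[ i ] i < N × name i ≡ c
    same    : f ≐[ N ] name

classes-resize : ∀ {N N′ k f} → N ≡ N′ → Classes N k f → Classes N′ k f
classes-resize refl C = C

-- Positions of the line when the point 0 is linked to the point 1 + M + p as its
-- nearest neighbour.  The points strictly between them (inj₁) are numbered after a
-- rotation that brings the last p of them to the front; the points from 1 + M + p on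
-- (inj₂) are numbered from 0, and 0 itself shares the number of 1 + M + p.
module Frame (M p : ℕ) where

  data At : ℕ → ℕ ⊎ ℕ → Set where
    start  : At 0 (inj₂ 0)
    near   : ∀ {y} → y < M → At (suc y) (inj₁ (p + y))
    far    : ∀ {x} → x < p → At (suc (M + x)) (inj₁ x)
    beyond : ∀ {x} → At (suc (M + (p + x))) (inj₂ x)

  locate : ∀ i → ∃ (At i)
  locate zero = _ , start
  locate (suc y) with y <? M
  ... | yes y<M = _ , near y<M
  ... | no y≮M with y ∸ M | ℕ.m+[n∸m]≡n (ℕ.≮⇒≥ y≮M)
  ...   | z | refl with z <? p
  ...     | yes z<p = _ , far z<p
  ...     | no z≮p with z ∸ p | ℕ.m+[n∸m]≡n (ℕ.≮⇒≥ z≮p)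
  ...       | x | refl = _ , beyond

  at-functional : ∀ {i v w} → At i v → At i w → v ≡ w
  at-functional {i} P Q = go P Q refl
    where
    clash : ∀ {y z} → y < M → y ≡ M + z → ⊥
    clash y<M refl = ℕ.m+n≮m M _ y<M
    clash′ : ∀ {x z} → x < p → M + x ≡ M + (p + z) → ⊥
    clash′ x<p e with refl ← ℕ.+-cancelˡ-≡ M _ _ e = ℕ.m+n≮m p _ x<p
    go : ∀ {i j v w} → At i v → At j w → i ≡ j → v ≡ w
    go start start _ = refl
    go (near _) (near _) e = cong (inj₁ ∘ (p +_)) (ℕ.suc-injective e)
    go (near y<M) (far _) e = ⊥-elim (clash y<M (ℕ.suc-injective e))
    go (near y<M) beyond e = ⊥-elim (clash y<M (ℕ.suc-injective e))
    go (far _) (near y<M) e = ⊥-elim (clash y<M (sym (ℕ.suc-injective e)))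
    go (far _) (far _) e = cong inj₁ (ℕ.+-cancelˡ-≡ M _ _ (ℕ.suc-injective e))
    go (far x<p) beyond e = ⊥-elim (clash′ x<p (ℕ.suc-injective e))
    go beyond (near y<M) e = ⊥-elim (clash y<M (sym (ℕ.suc-injective e)))
    go beyond (far x<p) e = ⊥-elim (clash′ x<p (sym (ℕ.suc-injective e)))
    go beyond beyond e = cong inj₂ (ℕ.+-cancelˡ-≡ p _ _ (ℕ.+-cancelˡ-≡ M _ _ (ℕ.suc-injective e)))

  φ : ℕ → ℕ ⊎ ℕ
  φ = proj₁ ∘ locate

  φ-at : ∀ {i v} → At i v → φ i ≡ v
  φ-at {i} P = at-functional (proj₂ (locate i)) P

  -- A section of `φ`: of the two points numbered `inj₂ 0` it selects the neighbour, not 0.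
  ψ : ℕ ⊎ ℕ → ℕ
  ψ (inj₁ x) with x <? p
  ... | yes _ = suc (M + x)
  ... | no _ = suc (x ∸ p)
  ψ (inj₂ x) = suc (M + (p + x))

  ψ-near : ∀ y → ψ (inj₁ (p + y)) ≡ suc y
  ψ-near y with p + y <? p
  ... | yes lt = contradiction lt (ℕ.m+n≮m p y)
  ... | no _ = cong suc (ℕ.m+n∸m≡n p y)

  ψ-far : ∀ {x} → x < p → ψ (inj₁ x) ≡ suc (M + x)
  ψ-far {x} x<p with x <? p
  ... | yes _ = refl
  ... | no x≮p = contradiction x<p x≮p

  ψ-at : ∀ {i v} → At i v → i ≡ ψ v ⊎ (i ≡ 0 × v ≡ inj₂ 0)
  ψ-at start = inj₂ (refl , refl)
  ψ-at (near {y} _) = inj₁ (sym (ψ-near y))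
  ψ-at (far x<p) = inj₁ (sym (ψ-far x<p))
  ψ-at beyond = inj₁ refl

  -- The neighbour of 0. The summand `p + 0` is kept so that `beyond` applies to it definitionally.
  q₀ : ℕ
  q₀ = suc (M + (p + 0))

  -- The outer numbering is strictly increasing except on the pair of 0 and `q₀`, which share the
  -- number 0.
  data Outer< : ℕ → ℕ → ℕ → ℕ → Set where
    strict : ∀ {i j x y} → x < y → Outer< i j x y
    glued  : ∀ {j} → Outer< 0 j 0 0

  outer-mono : ∀ {i j x y} → At i (inj₂ x) → At j (inj₂ y) → i < j → Outer< i j x y
  outer-mono start (beyond {zero}) _ = glued
  outer-mono start (beyond {suc y}) _ = strict z<s
  outer-mono beyond beyond (s≤s lt) = strict (ℕ.+-cancelˡ-< p _ _ (ℕ.+-cancelˡ-< M _ _ lt))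

  outer-inner : ∀ {i j x y} → At i (inj₂ x) → At j (inj₁ y) → i < j → i ≡ 0
  outer-inner start _ _ = refl
  outer-inner beyond (near y<M) (s≤s lt) = contradiction (<-trans lt y<M) (ℕ.m+n≮m M _)
  outer-inner beyond (far x<p) (s≤s lt) = contradiction (<-trans (ℕ.+-cancelˡ-< M _ _ lt) x<p) (ℕ.m+n≮m p _)

  inner<q₀ : ∀ {i x} → At i (inj₁ x) → 0 < i × i < q₀
  inner<q₀ (near y<M) = z<s , s≤s (ℕ.<-≤-trans y<M (ℕ.m≤m+n M _))
  inner<q₀ (far x<p) = z<s , s≤s (ℕ.+-monoʳ-< M (ℕ.<-≤-trans x<p (ℕ.m≤m+n p 0)))

  q₀≤outer : ∀ {i x} → At i (inj₂ x) → i ≡ 0 ⊎ q₀ ≤ i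
  q₀≤outer start = inj₁ refl
  q₀≤outer beyond = inj₂ (s≤s (ℕ.+-monoʳ-≤ M (ℕ.+-monoʳ-≤ p z≤n)))

  module Range (K : ℕ) (0<K : 0 < K) where

    total : ℕ
    total = suc (M + (p + K))

    InRange : ℕ ⊎ ℕ → Set
    InRange (inj₁ x) = x < p + M
    InRange (inj₂ x) = x < K

    at-range : ∀ {i v} → At i v → i < total → InRange v
    at-range start _ = 0<K
    at-range (near y<M) _ = ℕ.+-monoʳ-< p y<M
    at-range (far x<p) _ = ℕ.<-≤-trans x<p (ℕ.m≤m+n p M)
    at-range beyond (s≤s lt) = ℕ.+-cancelˡ-< p _ _ (ℕ.+-cancelˡ-< M _ _ lt)

    at-ψ : ∀ v → InRange v → At (ψ v) v × ψ v < total
    at-ψ (inj₂ x) x<K = beyond , s≤s (ℕ.+-monoʳ-< M (ℕ.+-monoʳ-< p x<K))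
    at-ψ (inj₁ x) x< with x <? p
    ... | yes x<p = far x<p , s≤s (ℕ.+-monoʳ-< M (ℕ.<-≤-trans x<p (ℕ.m≤m+n p K)))
    ... | no x≮p with x ∸ p | ℕ.m+[n∸m]≡n (ℕ.≮⇒≥ x≮p)
    ...   | y | refl = near y<M , s≤s (ℕ.<-≤-trans y<M (ℕ.m≤m+n M _))
      where y<M = ℕ.+-cancelˡ-< p _ _ x<

    q₀<total : q₀ < total
    q₀<total = s≤s (ℕ.+-monoʳ-< M (ℕ.+-monoʳ-< p 0<K))

    -- The common interface of both directions: cutting a given labelling and gluing the labels of
    -- two codes.
    record Splits (f f₁ f₂ : ℕ → ℕ) : Set where
      field
        inner    : ∀ {i j x y} → i < total → j < total → At i (inj₁ x) → At j (inj₁ y) →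
                   (f i ≡ f j → f₁ x ≡ f₁ y) × (f₁ x ≡ f₁ y → f i ≡ f j)
        outer    : ∀ {i j x y} → i < total → j < total → At i (inj₂ x) → At j (inj₂ y) →
                   (f i ≡ f j → f₂ x ≡ f₂ y) × (f₂ x ≡ f₂ y → f i ≡ f j)
        separate : ∀ {i j x y} → i < total → j < total → At i (inj₁ x) → At j (inj₂ y) → f i ≢ f j

    module _ {f f₁ f₂} (S : Splits f f₁ f₂) where
      open Splits S

      splits-nonCrossing : NonCrossingBelow (p + M) f₁ → NonCrossingBelow K f₂ → NonCrossingBelow total f
      splits-nonCrossing nc₁ nc₂ {a} {b} {c} {d} a<b b<c c<d d<N ac bd =
        go (proj₂ (locate a)) (proj₂ (locate b)) (proj₂ (locate c)) (proj₂ (locate d))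
        where
        c<N = <-trans c<d d<N
        b<N = <-trans b<c c<N
        a<N = <-trans a<b b<N
        go : ∀ {va vb vc vd} → At a va → At b vb → At c vc → At d vd → f a ≡ f b
        go {va = inj₁ _} {vc = inj₂ _} A _ C _ = contradiction ac (separate a<N c<N A C)
        go {va = inj₂ _} {vc = inj₁ _} A _ C _ = contradiction (sym ac) (separate c<N a<N C A)
        go {vb = inj₁ _} {vd = inj₂ _} _ B _ D = contradiction bd (separate b<N d<N B D)
        go {vb = inj₂ _} {vd = inj₁ _} _ B _ D = contradiction (sym bd) (separate d<N b<N D B)
        -- The inner points are consecutive right after 0, so an outer point that precedes an inner
        -- one must be 0, and nothing comes before 0.
        go {inj₁ _} {inj₂ _} {inj₁ _} {inj₂ _} A B C D =
          contradiction (subst (a <_) (outer-inner B C b<c) a<b) λ ()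
        go {inj₂ _} {inj₁ _} {inj₂ _} {inj₁ _} A B C D =
          contradiction (subst (b <_) (outer-inner C D c<d) b<c) λ ()
        go {inj₂ _} {inj₂ _} {inj₂ _} {inj₂ _} A B C D
          with outer-mono A B a<b | outer-mono B C b<c | outer-mono C D c<d
        ... | glued | _ | _ = proj₂ (outer a<N b<N A B) refl
        ... | strict x | strict y | strict z = proj₂ (outer a<N b<N A B)
              (nc₂ x y z (at-range D d<N) (proj₁ (outer a<N c<N A C) ac) (proj₁ (outer b<N d<N B D) bd))
        ... | strict _ | glued | _ = contradiction a<b λ ()
        ... | strict _ | strict _ | glued = contradiction b<c λ ()
        go {inj₁ _} {inj₁ _} {inj₁ _} {inj₁ _} A B C D = proj₂ (inner a<N b<N A B)
          (rotate A B C D (at-range A a<N) (at-range B b<N) (at-range C c<N) (at-range D d<N) a<b b<c c<d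
            (proj₁ (inner a<N c<N A C) ac) (proj₁ (inner b<N d<N B D) bd))
          where
          wrap : ∀ {x y} → x < p → x < p + y
          wrap {y = y} x<p = ℕ.<-≤-trans x<p (ℕ.m≤m+n p y)
          keep : ∀ {y z} → suc y < suc z → p + y < p + z
          keep (s≤s lt) = ℕ.+-monoʳ-< p lt
          keep′ : ∀ {y z} → suc (M + y) < suc (M + z) → y < z
          keep′ (s≤s lt) = ℕ.+-cancelˡ-< M _ _ lt
          bad : ∀ {x y} {P : Set} → y < M → suc (M + x) < suc y → P
          bad y<M (s≤s lt) = contradiction (<-trans lt y<M) (ℕ.m+n≮m M _)
          -- Non-crossing is invariant under rotation: those of the four points that are `far` move
          -- to the front, and `nc₁` applies to the cyclically shifted quadruple.
          rotate : ∀ {a b c d xa xb xc xd} → At a (inj₁ xa) → At b (inj₁ xb) → At c (inj₁ xc) → At d (inj₁ xd) →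
            xa < p + M → xb < p + M → xc < p + M → xd < p + M →
            a < b → b < c → c < d → f₁ xa ≡ f₁ xc → f₁ xb ≡ f₁ xd → f₁ xa ≡ f₁ xb
          rotate (near _) (near _) (near _) (near _) _ _ _ ld ab bc cd e e′ =
            nc₁ (keep ab) (keep bc) (keep cd) ld e e′
          rotate (near _) (near _) (near _) (far d<p) _ _ lc _ ab bc cd e e′ =
            trans (sym (nc₁ (wrap d<p) (keep ab) (keep bc) lc (sym e′) e)) (sym e′)
          rotate (near _) (near _) (far c<p) (far d<p) _ lb _ _ ab bc cd e e′ =
            trans e (trans (nc₁ (keep′ cd) (wrap d<p) (keep ab) lb (sym e) (sym e′)) (sym e′))
          rotate (near _) (far b<p) (far c<p) (far d<p) la _ _ _ ab bc cd e e′ =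
            trans e (sym (nc₁ (keep′ bc) (keep′ cd) (wrap d<p) la e′ (sym e)))
          rotate (far _) (far _) (far _) (far _) _ _ _ ld ab bc cd e e′ =
            nc₁ (keep′ ab) (keep′ bc) (keep′ cd) ld e e′
          rotate (far _) (near y<M) _ _ _ _ _ _ ab _ _ _ _ = bad y<M ab
          rotate _ (far _) (near y<M) _ _ _ _ _ _ bc _ _ _ = bad y<M bc
          rotate _ _ (far _) (near y<M) _ _ _ _ _ _ cd _ _ = bad y<M cd

      isolates : ∀ {i} → 0 < i → i < q₀ → f 0 ≢ f i
      isolates {i} 0<i i<q₀ e with locate i
      ... | inj₁ _ , P = separate (<-trans i<q₀ q₀<total) z<s P start (sym e)
      ... | inj₂ _ , P with q₀≤outer P
      ...   | inj₁ refl = <-irrefl refl 0<i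
      ...   | inj₂ q₀≤i = <-irrefl refl (ℕ.<-≤-trans i<q₀ q₀≤i)

      links : f 0 ≡ f q₀
      links = proj₂ (outer z<s q₀<total start beyond) refl

      splits-classes : ∀ {k₁ k₂} → Classes (p + M) k₁ f₁ → Classes K k₂ f₂ → Classes total (k₁ + k₂) f
      splits-classes {k₁} {k₂} C₁ C₂ = record
        { name = h ∘ φ ; name< = h< ; onto = h-onto ; same = same }
        where
        module C₁ = Classes C₁
        module C₂ = Classes C₂
        h : ℕ ⊎ ℕ → ℕ
        h = [ C₁.name , (λ y → k₁ + C₂.name y) ]′
        h< : ∀ {i} → i < total → h (φ i) < k₁ + k₂
        h< {i} i< with locate i
        ... | inj₁ x , P = ℕ.<-≤-trans (C₁.name< (at-range P i<)) (ℕ.m≤m+n k₁ k₂)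
        ... | inj₂ y , P = ℕ.+-monoʳ-< k₁ (C₂.name< (at-range P i<))
        h-onto : ∀ {c} → c < k₁ + k₂ → ∃[ i ] i < total × h (φ i) ≡ c
        h-onto {c} c< with c <? k₁
        ... | yes c<k₁ = let (x , x< , e) = C₁.onto c<k₁ ; (P , i<) = at-ψ (inj₁ x) x< in
              _ , i< , trans (cong h (φ-at P)) e
        ... | no c≮k₁ with c ∸ k₁ | ℕ.m+[n∸m]≡n (ℕ.≮⇒≥ c≮k₁)
        ...   | c′ | refl = let (x , x< , e) = C₂.onto (ℕ.+-cancelˡ-< k₁ _ _ c<)
                                (P , i<) = at-ψ (inj₂ x) x< in
              _ , i< , trans (cong h (φ-at P)) (cong (k₁ +_) e)
        same : f ≐[ total ] h ∘ φ
        same {i} {j} i< j< with locate i | locate j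
        ... | inj₁ x , P | inj₁ y , Q =
              let (to , from) = inner i< j< P Q
                  (to′ , from′) = C₁.same (at-range P i<) (at-range Q j<) in
              to′ ∘ to , from ∘ from′
        ... | inj₂ x , P | inj₂ y , Q =
              let (to , from) = outer i< j< P Q
                  (to′ , from′) = C₂.same (at-range P i<) (at-range Q j<) in
              cong (k₁ +_) ∘ to′ ∘ to , from ∘ from′ ∘ ℕ.+-cancelˡ-≡ k₁ _ _
        ... | inj₁ x , P | inj₂ y , Q = (λ e → contradiction e (separate i< j< P Q))
              , λ e → contradiction (subst (_< k₁) e (C₁.name< (at-range P i<))) (ℕ.m+n≮m k₁ _)
        ... | inj₂ x , P | inj₁ y , Q = (λ e → contradiction (sym e) (separate j< i< Q P))
              , λ e → contradiction (subst (_< k₁) (sym e) (C₁.name< (at-range Q j<))) (ℕ.m+n≮m k₁ _)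

    module _ {f f₁ f₂ g g₁ g₂} (S : Splits f f₁ f₂) (T : Splits g g₁ g₂) where
      private
        module S = Splits S
        module T = Splits T

      splits-≐ : f₁ ≐[ p + M ] g₁ → f₂ ≐[ K ] g₂ → f ≐[ total ] g
      splits-≐ e₁ e₂ {i} {j} i< j< with locate i | locate j
      ... | inj₁ x , P | inj₁ y , Q =
            let (to , from) = e₁ (at-range P i<) (at-range Q j<) in
            (proj₂ (T.inner i< j< P Q) ∘ to ∘ proj₁ (S.inner i< j< P Q))
          , (proj₂ (S.inner i< j< P Q) ∘ from ∘ proj₁ (T.inner i< j< P Q))
      ... | inj₂ x , P | inj₂ y , Q =
            let (to , from) = e₂ (at-range P i<) (at-range Q j<) in
            (proj₂ (T.outer i< j< P Q) ∘ to ∘ proj₁ (S.outer i< j< P Q))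
          , (proj₂ (S.outer i< j< P Q) ∘ from ∘ proj₁ (T.outer i< j< P Q))
      ... | inj₁ x , P | inj₂ y , Q = (λ e → contradiction e (S.separate i< j< P Q))
              , (λ e → contradiction e (T.separate i< j< P Q))
      ... | inj₂ x , P | inj₁ y , Q = (λ e → contradiction (sym e) (S.separate j< i< Q P))
              , (λ e → contradiction (sym e) (T.separate j< i< Q P))

      splits-≐⁻ : f ≐[ total ] g → f₁ ≐[ p + M ] g₁ × f₂ ≐[ K ] g₂
      splits-≐⁻ e = left , right
        where
        left : f₁ ≐[ p + M ] g₁
        left {x} {y} x< y< =
          let (P , i<) = at-ψ (inj₁ x) x< ; (Q , j<) = at-ψ (inj₁ y) y< ; (to , from) = e i< j< in
            (proj₁ (T.inner i< j< P Q) ∘ to ∘ proj₂ (S.inner i< j< P Q))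
          , (proj₁ (S.inner i< j< P Q) ∘ from ∘ proj₂ (T.inner i< j< P Q))
        right : f₂ ≐[ K ] g₂
        right {x} {y} x< y< =
          let (P , i<) = at-ψ (inj₂ x) x< ; (Q , j<) = at-ψ (inj₂ y) y< ; (to , from) = e i< j< in
            (proj₁ (T.outer i< j< P Q) ∘ to ∘ proj₂ (S.outer i< j< P Q))
          , (proj₁ (S.outer i< j< P Q) ∘ from ∘ proj₂ (T.outer i< j< P Q))

    splits-glue : ∀ {f₁ f₂ : ℕ → ℕ} k → (∀ {x} → x < p + M → f₁ x < k) →
      Splits ([ f₁ , (λ y → k + f₂ y) ]′ ∘ φ) f₁ f₂
    splits-glue {f₁} {f₂} k f₁< = record
      { inner = λ i< j< P Q → (λ e → trans (sym (at P)) (trans e (at Q)))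
                            , (λ e → trans (at P) (trans e (sym (at Q))))
      ; outer = λ i< j< P Q → (λ e → ℕ.+-cancelˡ-≡ k _ _ (trans (sym (at P)) (trans e (at Q))))
                            , (λ e → trans (at P) (trans (cong (k +_) e) (sym (at Q))))
      ; separate = λ i< j< P Q e → ℕ.m+n≮m k _
          (subst (_< k) (trans (sym (at P)) (trans e (at Q))) (f₁< (at-range P i<)))
      }
      where
      at : ∀ {i v} → At i v → [ f₁ , (λ y → k + f₂ y) ]′ (φ i) ≡ [ f₁ , (λ y → k + f₂ y) ]′ v
      at P = cong [ f₁ , (λ y → k + f₂ y) ]′ (φ-at P)

    module _ {f : ℕ → ℕ} (nc : NonCrossingBelow total f) (0~q₀ : f 0 ≡ f q₀)
             (least : ∀ {i} → 0 < i → i < q₀ → f 0 ≢ f i) where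

      private
        back : ∀ {i v} → At i v → f i ≡ f (ψ v)
        back P with ψ-at P
        ... | inj₁ e = cong f e
        ... | inj₂ (refl , refl) = 0~q₀

      -- A class with points on both sides would contain 0 or `q₀`, or cross the chord between them;
      -- each contradicts that `q₀` is the nearest neighbour of 0.
      splits-at-least : Splits f (f ∘ ψ ∘ inj₁) (f ∘ ψ ∘ inj₂)
      splits-at-least = record
        { inner = λ _ _ P Q → (λ e → trans (sym (back P)) (trans e (back Q)))
                          , (λ e → trans (back P) (trans e (sym (back Q))))
        ; outer = λ _ _ P Q → (λ e → trans (sym (back P)) (trans e (back Q)))
                          , (λ e → trans (back P) (trans e (sym (back Q))))
        ; separate = apart
        }
        where
        apart : ∀ {i j x y} → i < total → j < total → At i (inj₁ x) → At j (inj₂ y) → f i ≢ f j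
        apart {i} {j} i< j< P Q e with inner<q₀ P | q₀≤outer Q
        ... | 0<i , i<q₀ | inj₁ refl = least 0<i i<q₀ (sym e)
        ... | 0<i , i<q₀ | inj₂ q₀≤j with ℕ.m≤n⇒m<n∨m≡n q₀≤j
        ...   | inj₂ refl = least 0<i i<q₀ (trans 0~q₀ (sym e))
        ...   | inj₁ q₀<j = least 0<i i<q₀ (nc 0<i i<q₀ q₀<j j< 0~q₀ e)

      outer-nonCrossing : NonCrossingBelow K (f ∘ ψ ∘ inj₂)
      outer-nonCrossing ab bc cd d<K = nc (up ab) (up bc) (up cd) (up d<K)
        where
        up : ∀ {x y} → x < y → suc (M + (p + x)) < suc (M + (p + y))
        up lt = s≤s (ℕ.+-monoʳ-< M (ℕ.+-monoʳ-< p lt))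

      inner-nonCrossing : NonCrossingBelow (p + M) (f ∘ ψ ∘ inj₁)
      inner-nonCrossing {a} {b} {c} {d} ab bc cd d< = rotate
        (proj₁ (at-ψ (inj₁ a) a<)) (proj₁ (at-ψ (inj₁ b) b<)) (proj₁ (at-ψ (inj₁ c) c<)) (proj₁ (at-ψ (inj₁ d) d<))
        (proj₂ (at-ψ (inj₁ a) a<)) (proj₂ (at-ψ (inj₁ b) b<)) (proj₂ (at-ψ (inj₁ c) c<)) (proj₂ (at-ψ (inj₁ d) d<))
        ab bc cd
        where
        c< = <-trans cd d<
        b< = <-trans bc c<
        a< = <-trans ab b<
        wrap : ∀ {x y} → y < M → suc y < suc (M + x)
        wrap y<M = s≤s (ℕ.<-≤-trans y<M (ℕ.m≤m+n M _))
        keep : ∀ {y z} → p + y < p + z → suc y < suc z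
        keep lt = s≤s (ℕ.+-cancelˡ-< p _ _ lt)
        keep′ : ∀ {y z} → y < z → suc (M + y) < suc (M + z)
        keep′ lt = s≤s (ℕ.+-monoʳ-< M lt)
        bad : ∀ {x y} {P : Set} → x < p → p + y < x → P
        bad x<p lt = contradiction (<-trans lt x<p) (ℕ.m+n≮m p _)
        rotate : ∀ {a b c d xa xb xc xd} → At a (inj₁ xa) → At b (inj₁ xb) → At c (inj₁ xc) → At d (inj₁ xd) →
          a < total → b < total → c < total → d < total →
          xa < xb → xb < xc → xc < xd → f a ≡ f c → f b ≡ f d → f a ≡ f b
        rotate (near _) (near _) (near _) (near _) _ _ _ ld ab bc cd e e′ =
          nc (keep ab) (keep bc) (keep cd) ld e e′
        rotate (far _) (far _) (far _) (far _) _ _ _ ld ab bc cd e e′ =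
          nc (keep′ ab) (keep′ bc) (keep′ cd) ld e e′
        rotate (far _) (far _) (far _) (near d<M) _ _ lc _ ab bc cd e e′ =
          trans (sym (nc (wrap d<M) (keep′ ab) (keep′ bc) lc (sym e′) e)) (sym e′)
        rotate (far _) (far _) (near c<M) (near d<M) _ lb _ _ ab bc cd e e′ =
          trans e (trans (nc (keep cd) (wrap d<M) (keep′ ab) lb (sym e) (sym e′)) (sym e′))
        rotate (far _) (near b<M) (near c<M) (near d<M) la _ _ _ ab bc cd e e′ =
          trans e (sym (nc (keep bc) (keep cd) (wrap d<M) la e′ (sym e)))
        rotate (near _) (far x<p) _ _ _ _ _ _ ab _ _ _ _ = bad x<p ab
        rotate _ (near _) (far x<p) _ _ _ _ _ _ bc _ _ _ = bad x<p bc
        rotate _ _ (near _) (far x<p) _ _ _ _ _ _ cd _ _ = bad x<p cd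

-- Codes of the tree-like partitions

module Codes (l : ℕ) where

  ℓ : ℕ
  ℓ = suc l

  size : ℕ → ℕ → ℕ
  size a s = a + s * ℓ

  -- Colourings compatible with the blocks of f and with the groups of points: an
  -- initial group of a points, which is coloured true, and then s groups of ℓ points.
  record Closed (a s : ℕ) (f : ℕ → ℕ) (χ : ℕ → Bool) : Set where
    field
      initial  : ∀ {i} → i < a → χ i ≡ true
      grouped : ∀ {k x y} → k < s → x < ℓ → y < ℓ → χ (a + (k * ℓ + x)) ≡ χ (a + (k * ℓ + y))
      respects : ∀ {i j} → i < size a s → j < size a s → f i ≡ f j → χ i ≡ χ j

  -- Connected to the initial group. For `a = 0` and `s > 0` the constant colouring `false` refutes
  -- it, matching the absence of codes there.
  Connected : ℕ → ℕ → (ℕ → ℕ) → Set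
  Connected a s f = ∀ χ → Closed a s f χ → ∀ {i} → i < size a s → χ i ≡ true

  closed-const : ∀ {a s f} → Closed a s f (λ _ → true)
  closed-const = record { initial = λ _ → refl ; grouped = λ _ _ _ → refl ; respects = λ _ _ _ → refl }

  -- The link from 0 to point `p` of interval `t` attaches this interval to the group. Its first `p`
  -- points lie inside, and the rotation puts them directly before the `a` remaining points of the
  -- group; its last `ℓ ∸ p` points become the outer group.
  module ArcFrame (a s t u p : ℕ) (p<ℓ : p < ℓ) (t+u≡s : t + u ≡ s) where

    M K : ℕ
    M = size a t
    K = size (ℓ ∸ p) u

    0<ℓ∸p : 0 < ℓ ∸ p
    0<ℓ∸p = ℕ.m<n⇒0<n∸m p<ℓ

    open Frame M p public
    open Range K (ℕ.<-≤-trans 0<ℓ∸p (ℕ.m≤m+n _ _)) public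

    inner-size : p + M ≡ size (p + a) t
    inner-size = sym (ℕ.+-assoc p a (t * ℓ))

    private
      p+[ℓ∸p]≡ℓ : p + (ℓ ∸ p) ≡ ℓ
      p+[ℓ∸p]≡ℓ = ℕ.m+[n∸m]≡n (ℕ.<⇒≤ p<ℓ)

      skip-arc : ∀ k x → M + (p + ((ℓ ∸ p) + (k * ℓ + x))) ≡ a + ((suc t + k) * ℓ + x)
      skip-arc k x = trans (regroup a (t * ℓ) p (ℓ ∸ p) (k * ℓ + x))
        (trans (cong (λ q → a + (t * ℓ + (q + (k * ℓ + x)))) p+[ℓ∸p]≡ℓ) (distribute a t k ℓ x))
        where
        regroup : ∀ a b c d e → (a + b) + (c + (d + e)) ≡ a + (b + ((c + d) + e))
        regroup = solve-∀
        distribute : ∀ a t k ℓ x → a + (t * ℓ + (ℓ + (k * ℓ + x))) ≡ a + ((suc t + k) * ℓ + x)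
        distribute = solve-∀

      at-arc : ∀ x → M + x ≡ a + (t * ℓ + x)
      at-arc x = ℕ.+-assoc a (t * ℓ) x

    total-size : total ≡ size (suc a) (suc s)
    total-size = cong suc (trans (cong (λ z → M + (p + ((ℓ ∸ p) + z))) (sym (ℕ.+-identityʳ (u * ℓ))))
      (trans (skip-arc u 0) (cong (a +_) (trans (ℕ.+-identityʳ _) (cong (λ v → suc v * ℓ) t+u≡s)))))

    to-size : ∀ {i} → i < total → i < size (suc a) (suc s)
    to-size {i} = subst (i <_) total-size

    of-size : ∀ {i} → i < size (suc a) (suc s) → i < total
    of-size {i} = subst (i <_) (sym total-size)

    module _ {f f₁ f₂} (S : Splits f f₁ f₂) where
      open Splits S

      closed-join : ∀ {χ₁ χ₂} → Closed (p + a) t f₁ χ₁ → Closed (ℓ ∸ p) u f₂ χ₂ →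
        Closed (suc a) (suc s) f ([ χ₁ , χ₂ ]′ ∘ φ)
      closed-join {χ₁} {χ₂} C₁ C₂ = record { initial = initial ; grouped = grouped ; respects = respects }
        where
        module C₁ = Closed C₁
        module C₂ = Closed C₂
        χ = [ χ₁ , χ₂ ]′ ∘ φ
        value : ∀ {i v} → At i v → χ i ≡ [ χ₁ , χ₂ ]′ v
        value P = cong [ χ₁ , χ₂ ]′ (φ-at P)
        initial : ∀ {i} → i < suc a → χ i ≡ true
        initial {zero} _ = C₂.initial 0<ℓ∸p
        initial {suc y} (s≤s y<a) = trans (value (near (ℕ.<-≤-trans y<a (ℕ.m≤m+n a _))))
          (C₁.initial (ℕ.+-monoʳ-< p y<a))
        before : ∀ {k x} → k < t → x < ℓ → χ (suc a + (k * ℓ + x)) ≡ χ₁ ((p + a) + (k * ℓ + x))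
        before {k} {x} k<t x<ℓ = trans (value (near (ℕ.+-monoʳ-< a
            (ℕ.<-≤-trans (ℕ.+-monoʳ-< (k * ℓ) x<ℓ)
              (≤-trans (ℕ.≤-reflexive (ℕ.+-comm (k * ℓ) ℓ)) (ℕ.*-monoˡ-≤ ℓ k<t))))))
          (cong χ₁ (sym (ℕ.+-assoc p a _)))
        -- Both halves of the cut interval lie in initial groups, so the glued colouring is constant
        -- on it.
        here : ∀ {x} → x < ℓ → χ (suc a + (t * ℓ + x)) ≡ true
        here {x} x<ℓ with x <? p
        ... | yes x<p = trans (cong (χ ∘ suc) (sym (at-arc x)))
              (trans (value (far x<p)) (C₁.initial (ℕ.<-≤-trans x<p (ℕ.m≤m+n p a))))
        ... | no x≮p with x ∸ p | ℕ.m+[n∸m]≡n (ℕ.≮⇒≥ x≮p)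
        ...   | z | refl = trans (cong (χ ∘ suc) (sym (at-arc (p + z))))
              (trans (value beyond) (C₂.initial (ℕ.+-cancelˡ-< p _ _ (subst (p + z <_) (sym p+[ℓ∸p]≡ℓ) x<ℓ))))
        after : ∀ k x → χ (suc a + ((suc t + k) * ℓ + x)) ≡ χ₂ ((ℓ ∸ p) + (k * ℓ + x))
        after k x = trans (cong (χ ∘ suc) (sym (skip-arc k x))) (value beyond)
        grouped : ∀ {k x y} → k < suc s → x < ℓ → y < ℓ → χ (suc a + (k * ℓ + x)) ≡ χ (suc a + (k * ℓ + y))
        grouped {k} {x} {y} k< x< y< with <-cmp k t
        ... | tri< k<t _ _ = trans (before k<t x<) (trans (C₁.grouped k<t x< y<) (sym (before k<t y<)))
        ... | tri≈ _ refl _ = trans (here x<) (sym (here y<))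
        ... | tri> _ _ t<k with k ∸ suc t | ℕ.m+[n∸m]≡n t<k
        ...   | k′ | refl = trans (after k′ x) (trans (C₂.grouped k′<u x< y<) (sym (after k′ y)))
          where
          k′<u : k′ < u
          k′<u = ℕ.+-cancelˡ-< t _ _ (subst (t + k′ <_) (sym t+u≡s) (ℕ.≤-pred k<))
        respects : ∀ {i j} → i < size (suc a) (suc s) → j < size (suc a) (suc s) → f i ≡ f j → χ i ≡ χ j
        respects {i} {j} i<′ j<′ e = go (locate i) (locate j)
          where
          i< = of-size i<′
          j< = of-size j<′
          go : ∃ (At i) → ∃ (At j) → χ i ≡ χ j
          go (inj₁ x , P) (inj₁ y , Q) = trans (value P) (trans
            (C₁.respects (subst (x <_) inner-size (at-range P i<)) (subst (y <_) inner-size (at-range Q j<))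
              (proj₁ (inner i< j< P Q) e)) (sym (value Q)))
          go (inj₂ x , P) (inj₂ y , Q) = trans (value P) (trans
            (C₂.respects (at-range P i<) (at-range Q j<) (proj₁ (outer i< j< P Q) e)) (sym (value Q)))
          go (inj₁ x , P) (inj₂ y , Q) = contradiction e (separate i< j< P Q)
          go (inj₂ x , P) (inj₁ y , Q) = contradiction (sym e) (separate j< i< Q P)

      -- A closed colouring of one side extends by the constant `true` to the other side.
      connected-split : Connected (suc a) (suc s) f → Connected (p + a) t f₁ × Connected (ℓ ∸ p) u f₂
      connected-split conn =
          (λ χ C {x} x< → let (P , i<) = at-ψ (inj₁ x) (subst (x <_) (sym inner-size) x<) in
             trans (sym (cong [ χ , (λ _ → true) ]′ (φ-at P))) (conn _ (closed-join C closed-const) (to-size i<)))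
        , (λ χ C {x} x< → let (P , i<) = at-ψ (inj₂ x) x< in
             trans (sym (cong [ (λ _ → true) , χ ]′ (φ-at P))) (conn _ (closed-join closed-const C) (to-size i<)))

      closed-split : ∀ {χ} → Closed (suc a) (suc s) f χ →
        Closed (p + a) t f₁ (χ ∘ ψ ∘ inj₁) × Closed (ℓ ∸ p) u f₂ (χ ∘ ψ ∘ inj₂)
      closed-split {χ} C =
          record { initial = initial₁ ; grouped = grouped₁ ; respects = respects₁ }
        , record { initial = λ x< → trans (cong (χ ∘ suc) (at-arc _)) (group (p+-< x<))
                 ; grouped = grouped₂ ; respects = respects₂ }
        where
        module C = Closed C
        p+-< : ∀ {x} → x < ℓ ∸ p → p + x < ℓ
        p+-< {x} x< = subst (p + x <_) p+[ℓ∸p]≡ℓ (ℕ.+-monoʳ-< p x<)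
        t<s : t < suc s
        t<s = s≤s (subst (t ≤_) t+u≡s (ℕ.m≤m+n t u))
        -- The colour `true` passes from 0 over the link to `q₀` and from there to the whole cut
        -- interval.
        χq₀ : χ q₀ ≡ true
        χq₀ = trans (sym (C.respects z<s (to-size q₀<total)
          (links S))) (C.initial z<s)
        group : ∀ {x} → x < ℓ → χ (suc (a + (t * ℓ + x))) ≡ true
        group {x} x<ℓ = trans (C.grouped t<s x<ℓ (p+-< 0<ℓ∸p)) (trans (cong (χ ∘ suc) (sym (at-arc (p + 0)))) χq₀)
        initial₁ : ∀ {x} → x < p + a → χ (ψ (inj₁ x)) ≡ true
        initial₁ {x} x< with x <? p
        ... | yes x<p = trans (cong (χ ∘ suc) (at-arc x)) (group (<-trans x<p p<ℓ))
        ... | no x≮p = C.initial (s≤s (ℕ.+-cancelˡ-< p _ _ (subst (_< p + a) (sym (ℕ.m+[n∸m]≡n (ℕ.≮⇒≥ x≮p))) x<)))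
        near₁ : ∀ z → χ (ψ (inj₁ (p + a + z))) ≡ χ (suc a + z)
        near₁ z = trans (cong (χ ∘ ψ ∘ inj₁) (ℕ.+-assoc p a z)) (cong χ (ψ-near (a + z)))
        grouped₁ : ∀ {k x y} → k < t → x < ℓ → y < ℓ →
          χ (ψ (inj₁ (p + a + (k * ℓ + x)))) ≡ χ (ψ (inj₁ (p + a + (k * ℓ + y))))
        grouped₁ {k} {x} {y} k<t x< y< = trans (near₁ (k * ℓ + x))
          (trans (C.grouped (<-trans k<t t<s) x< y<) (sym (near₁ (k * ℓ + y))))
        grouped₂ : ∀ {k x y} → k < u → x < ℓ → y < ℓ →
          χ (ψ (inj₂ ((ℓ ∸ p) + (k * ℓ + x)))) ≡ χ (ψ (inj₂ ((ℓ ∸ p) + (k * ℓ + y))))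
        grouped₂ {k} {x} {y} k<u x< y< = trans (cong (χ ∘ suc) (skip-arc k x))
          (trans (C.grouped (s≤s (subst (t + k <_) t+u≡s (ℕ.+-monoʳ-< t k<u))) x< y<)
            (cong (χ ∘ suc) (sym (skip-arc k y))))
        respects₁ : ∀ {x y} → x < size (p + a) t → y < size (p + a) t → f₁ x ≡ f₁ y → χ (ψ (inj₁ x)) ≡ χ (ψ (inj₁ y))
        respects₁ {x} {y} x< y< e = let (P , i<) = at-ψ (inj₁ x) (subst (x <_) (sym inner-size) x<)
                                        (Q , j<) = at-ψ (inj₁ y) (subst (y <_) (sym inner-size) y<) in
          C.respects (to-size i<) (to-size j<) (proj₂ (inner i< j< P Q) e)
        respects₂ : ∀ {x y} → x < K → y < K → f₂ x ≡ f₂ y → χ (ψ (inj₂ x)) ≡ χ (ψ (inj₂ y))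
        respects₂ {x} {y} x< y< e = let (P , i<) = at-ψ (inj₂ x) x<
                                        (Q , j<) = at-ψ (inj₂ y) y< in
          C.respects (to-size i<) (to-size j<) (proj₂ (outer i< j< P Q) e)

      connected-join : Connected (p + a) t f₁ → Connected (ℓ ∸ p) u f₂ → Connected (suc a) (suc s) f
      connected-join conn₁ conn₂ χ C {i} i<′ = go (proj₂ (locate i))
        where
        i< = of-size i<′
        on : ∀ v → InRange v → χ (ψ v) ≡ true
        on (inj₁ x) x< = conn₁ _ (proj₁ (closed-split C)) (subst (x <_) inner-size x<)
        on (inj₂ x) x< = conn₂ _ (proj₂ (closed-split C)) x<
        go : ∀ {v} → At i v → χ i ≡ true
        go {v} P with ψ-at P
        ... | inj₁ e = trans (cong χ e) (on v (at-range P i<))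
        ... | inj₂ (refl , _) = Closed.initial C z<s

  -- Codes for a group of a points followed by s intervals of ℓ points: skip if the first
  -- point is alone, arc p t if its next neighbour is the p-th point of the t-th interval.
  data Code : ℕ → ℕ → Set where
    nil  : Code 0 0
    skip : ∀ {a s} → Code a s → Code (suc a) s
    arc  : ∀ {a s} (p : Fin ℓ) (t : Fin (suc s)) →
           Code (toℕ p + a) (toℕ t) → Code (ℓ ∸ toℕ p) (s ∸ toℕ t) → Code (suc a) (suc s)

  -- The number of blocks of a tree for `a > 0`: the edges are `size a s` points, and `s + 1` of the
  -- vertices are groups.
  weight : ℕ → ℕ → ℕ
  weight a s = a + s * l

  weight+s≡size : ∀ a s → weight a s + s ≡ size a s
  weight+s≡size a s = identity a s l
    where
    identity : ∀ a s l → (a + s * l) + s ≡ a + s * suc l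
    identity = solve-∀

  module Arc {a s : ℕ} (p : Fin ℓ) (t : Fin (suc s)) where

    t+u≡s : toℕ t + (s ∸ toℕ t) ≡ s
    t+u≡s = ℕ.m+[n∸m]≡n (Fin.toℕ≤pred[n] t)

    open ArcFrame a s (toℕ t) (s ∸ toℕ t) (toℕ p) (Fin.toℕ<n p) t+u≡s public

    weight-sum : weight (toℕ p + a) (toℕ t) + weight (ℓ ∸ toℕ p) (s ∸ toℕ t) ≡ weight (suc a) (suc s)
    weight-sum = trans (regroup (toℕ p) a (toℕ t) (ℓ ∸ toℕ p) (s ∸ toℕ t) l)
      (trans (cong₂ (λ x y → x + (a + y * l)) (ℕ.m+[n∸m]≡n (ℕ.<⇒≤ (Fin.toℕ<n p))) t+u≡s) (unfold l a s))
      where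
      regroup : ∀ p a t q u l → ((p + a) + t * l) + (q + u * l) ≡ (p + q) + (a + (t + u) * l)
      regroup = solve-∀
      unfold : ∀ l a s → suc l + (a + s * l) ≡ suc a + (l + s * l)
      unfold = solve-∀

  label : ∀ {a s} → Code a s → ℕ → ℕ
  label nil i = i
  label (skip c) zero = zero
  label (skip c) (suc i) = suc (label c i)
  label (arc {a} {s} p t c d) =
    [ label c , (λ y → weight (toℕ p + a) (toℕ t) + label d y) ]′ ∘ Arc.φ {a} {s} p t

  label< : ∀ {a s} (c : Code a s) {i} → i < size a s → label c i < weight a s
  label< (skip c) {zero} _ = z<s
  label< (skip c) {suc i} (s≤s i<) = s≤s (label< c i<)
  label< (arc {a} {s} p t c d) {i} i< = subst (label (arc p t c d) i <_) weight-sum (go (locate i))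
    where
    open Arc {a} {s} p t
    go : ((v , P) : ∃ (At i)) → [ label c , (λ y → weight (toℕ p + a) (toℕ t) + label d y) ]′ v <
      weight (toℕ p + a) (toℕ t) + weight (ℓ ∸ toℕ p) (s ∸ toℕ t)
    go (inj₁ x , P) = ℕ.<-≤-trans (label< c (subst (x <_) inner-size (at-range P (of-size i<)))) (ℕ.m≤m+n _ _)
    go (inj₂ x , P) = ℕ.+-monoʳ-< (weight (toℕ p + a) (toℕ t)) (label< d (at-range P (of-size i<)))

  module _ {a s} (p : Fin ℓ) (t : Fin (suc s))
    (c : Code (toℕ p + a) (toℕ t)) (d : Code (ℓ ∸ toℕ p) (s ∸ toℕ t)) where
    open Arc {a} {s} p t

    label-splits : Splits (label (arc {a} p t c d)) (label c) (label d)
    label-splits = splits-glue (weight (toℕ p + a) (toℕ t)) λ {x} x< → label< c (subst (x <_) inner-size x<)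

  classes-cons : ∀ {k f} → (∀ {j} → j < N → f 0 ≢ f (suc j)) → Classes N k (f ∘ suc) → Classes (suc N) (suc k) f
  classes-cons {N} {k} {f} alone C = record { name = name ; name< = name< ; onto = onto ; same = same }
    where
    module C = Classes C
    name : ℕ → ℕ
    name zero = zero
    name (suc i) = suc (C.name i)
    name< : ∀ {i} → i < suc N → name i < suc k
    name< {zero} _ = z<s
    name< {suc i} (s≤s i<) = s≤s (C.name< i<)
    onto : ∀ {c} → c < suc k → ∃[ i ] i < suc N × name i ≡ c
    onto {zero} _ = 0 , z<s , refl
    onto {suc c} (s≤s c<) = let (i , i< , e) = C.onto c< in suc i , s≤s i< , cong suc e
    same : f ≐[ suc N ] name
    same {zero} {zero} _ _ = (λ _ → refl) , (λ _ → refl)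
    same {zero} {suc j} _ (s≤s j<) = (λ e → contradiction e (alone j<)) , λ ()
    same {suc i} {zero} (s≤s i<) _ = (λ e → contradiction (sym e) (alone i<)) , λ ()
    same {suc i} {suc j} (s≤s i<) (s≤s j<) = let (to , from) = C.same i< j< in
      cong suc ∘ to , from ∘ ℕ.suc-injective

  classes-duplicate : ∀ {k f y} → y < N → f 0 ≡ f (suc y) → Classes N k (f ∘ suc) → Classes (suc N) k f
  classes-duplicate {N} {k} {f} {y} y<N 0~y C = record { name = name ; name< = name< ; onto = onto ; same = same }
    where
    module C = Classes C
    name : ℕ → ℕ
    name zero = C.name y
    name (suc i) = C.name i
    name< : ∀ {i} → i < suc N → name i < k
    name< {zero} _ = C.name< y<N
    name< {suc i} (s≤s i<) = C.name< i<
    onto : ∀ {c} → c < k → ∃[ i ] i < suc N × name i ≡ c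
    onto c< = let (i , i< , e) = C.onto c< in suc i , s≤s i< , e
    same : f ≐[ suc N ] name
    same {zero} {zero} _ _ = (λ _ → refl) , (λ _ → refl)
    same {zero} {suc j} _ (s≤s j<) = let (to , from) = C.same y<N j< in to ∘ trans (sym 0~y) , trans 0~y ∘ from
    same {suc i} {zero} (s≤s i<) _ = let (to , from) = C.same i< y<N in
      (λ e → to (trans e 0~y)) , (λ e → trans (from e) (sym 0~y))
    same {suc i} {suc j} (s≤s i<) (s≤s j<) = C.same i< j<

  label-classes : ∀ {a s} (c : Code a s) → Classes (size a s) (weight a s) (label c)
  label-classes nil = record { name = id ; name< = id ; onto = λ () ; same = λ () }
  label-classes (skip c) = classes-cons (λ _ ()) (classes-suc (label-classes c))
    where
    classes-suc : ∀ {k f} → Classes N k f → Classes N k (suc ∘ f)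
    classes-suc C = record { name = C.name ; name< = C.name< ; onto = C.onto
      ; same = λ i< j< → let (to , from) = C.same i< j< in to ∘ ℕ.suc-injective , cong suc ∘ from }
      where module C = Classes C
  label-classes (arc {a} {s} p t c d) = classes-resize total-size
    (subst (λ k → Classes total k (label (arc {a} p t c d))) weight-sum
      (splits-classes (label-splits p t c d) (classes-resize (sym inner-size) (label-classes c)) (label-classes d)))
    where open Arc {a} {s} p t

  label-nonCrossing : ∀ {a s} (c : Code a s) → NonCrossingBelow (size a s) (label c)
  label-nonCrossing (skip c) {zero} {_} {suc _} _ _ _ _ ()
  label-nonCrossing (skip c) {suc _} {suc _} {suc _} {suc _} (s≤s ab) (s≤s bc) (s≤s cd) (s≤s d<) e e′ =
    cong suc (label-nonCrossing c ab bc cd d< (ℕ.suc-injective e) (ℕ.suc-injective e′))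
  label-nonCrossing (arc {a} {s} p t c d) = subst (λ N → NonCrossingBelow N (label (arc {a} p t c d))) total-size
    (splits-nonCrossing (label-splits p t c d)
      (subst (λ N → NonCrossingBelow N (label c)) (sym inner-size) (label-nonCrossing c)) (label-nonCrossing d))
    where open Arc {a} {s} p t

  connected-cons : ∀ {a s f} → Connected a s (f ∘ suc) → Connected (suc a) s f
  connected-cons conn χ C {zero} _ = Closed.initial C z<s
  connected-cons conn χ C {suc i} (s≤s i<) = conn (χ ∘ suc) (record
    { initial = C.initial ∘ s≤s ; grouped = C.grouped
    ; respects = λ i< j< → C.respects (s≤s i<) (s≤s j<) }) i<
    where module C = Closed C

  connected-tail : ∀ {a s f} → (∀ {j} → j < size a s → f 0 ≡ f (suc j) → ∃[ y ] y < a × f 0 ≡ f (suc y)) →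
    Connected (suc a) s f → Connected a s (f ∘ suc)
  connected-tail {a} {s} {f} anchor conn χ C i< = conn χ⁺ (record
    { initial = initial ; grouped = C.grouped ; respects = respects }) (s≤s i<)
    where
    module C = Closed C
    χ⁺ : ℕ → Bool
    χ⁺ zero = true
    χ⁺ (suc i) = χ i
    initial : ∀ {i} → i < suc a → χ⁺ i ≡ true
    initial {zero} _ = refl
    initial {suc i} (s≤s i<) = C.initial i<
    anchored : ∀ {j} → j < size a s → f 0 ≡ f (suc j) → true ≡ χ j
    anchored j< e = let (y , y<a , e′) = anchor j< e in
      trans (sym (C.initial y<a)) (C.respects (ℕ.<-≤-trans y<a (ℕ.m≤m+n a _)) j< (trans (sym e′) e))
    respects : ∀ {i j} → i < size (suc a) s → j < size (suc a) s → f i ≡ f j → χ⁺ i ≡ χ⁺ j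
    respects {zero} {zero} _ _ _ = refl
    respects {zero} {suc j} _ (s≤s j<) e = anchored j< e
    respects {suc i} {zero} (s≤s i<) _ e = sym (anchored i< (sym e))
    respects {suc i} {suc j} (s≤s i<) (s≤s j<) e = C.respects i< j< e

  label-connected : ∀ {a s} (c : Code a s) → Connected a s (label c)
  label-connected nil χ C ()
  label-connected (skip c) = connected-cons λ χ C → label-connected c χ (record
    { initial = Closed.initial C ; grouped = Closed.grouped C
    ; respects = λ i< j< e → Closed.respects C i< j< (cong suc e) })
  label-connected (arc {a} {s} p t c d) = connected-join (label-splits p t c d) (label-connected c) (label-connected d)
    where open Arc {a} {s} p t

  module _ {a s : ℕ} (p p′ : Fin ℓ) (t t′ : Fin (suc s)) where

    private
      module F = Arc {a} {s} p t
      module F′ = Arc {a} {s} p′ t′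

    arc-q₀≮ : ∀ {c d c′ d′} →
      label (arc {a} p t c d) ≐[ size (suc a) (suc s) ] label (arc {a} p′ t′ c′ d′) → ¬ (F.q₀ < F′.q₀)
    arc-q₀≮ {c} {d} {c′} {d′} e lt = F′.isolates (label-splits p′ t′ c′ d′) z<s lt
      (proj₁ (e {0} {F.q₀} z<s (F.to-size F.q₀<total)) (F.links (label-splits p t c d)))

    -- Division with remainder: `q₀` is `1 + a + tℓ + p` with `p < ℓ`.
    q₀-injective : F.q₀ ≡ F′.q₀ → t ≡ t′ × p ≡ p′
    q₀-injective e = Fin.combine-injective t p t′ p′ (Fin.toℕ-injective (trans (Fin.toℕ-combine t p)
      (trans (cong (_+ toℕ p) (ℕ.*-comm ℓ (toℕ t))) (trans (ℕ.+-cancelˡ-≡ a _ _ shifted)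
        (trans (cong (_+ toℕ p′) (ℕ.*-comm (toℕ t′) ℓ)) (sym (Fin.toℕ-combine t′ p′)))))))
      where
      strip : ∀ t p → a + t * ℓ + (p + 0) ≡ a + (t * ℓ + p)
      strip t p = trans (cong (a + t * ℓ +_) (ℕ.+-identityʳ p)) (ℕ.+-assoc a (t * ℓ) p)
      shifted : a + (toℕ t * ℓ + toℕ p) ≡ a + (toℕ t′ * ℓ + toℕ p′)
      shifted = trans (sym (strip (toℕ t) (toℕ p)))
        (trans (ℕ.suc-injective e) (strip (toℕ t′) (toℕ p′)))

  skip≉arc : ∀ {a s} p t c′ d′ (c : Code a (suc s)) →
    ¬ (label (skip c) ≐[ size (suc a) (suc s) ] label (arc {a} p t c′ d′))
  skip≉arc {a} {s} p t c′ d′ c e = contradiction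
    (proj₂ (e z<s (to-size q₀<total)) (links (label-splits p t c′ d′))) λ ()
    where open Arc {a} {s} p t

  -- The kernel tells whether 0 is alone and, if not, what its nearest neighbour is; this fixes the
  -- first constructor and its parameters.
  label-injective : ∀ {a s} (c c′ : Code a s) → label c ≐[ size a s ] label c′ → c ≡ c′
  label-injective nil nil _ = refl
  label-injective (skip c) (skip c′) e = cong skip (label-injective c c′ λ i< j< →
    let (to , from) = e (s≤s i<) (s≤s j<) in
      ℕ.suc-injective ∘ to ∘ cong suc , ℕ.suc-injective ∘ from ∘ cong suc)
  label-injective (skip c) (arc p t c′ d′) e = ⊥-elim (skip≉arc p t c′ d′ c e)
  label-injective (arc p t c′ d′) (skip c) e = ⊥-elim (skip≉arc p t c′ d′ c
    λ i< j< → let (to , from) = e i< j< in from , to)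
  label-injective (arc {a} {s} p t c d) (arc p′ t′ c′ d′) e with <-cmp (Arc.q₀ {a} p t) (Arc.q₀ {a} p′ t′)
  ... | tri< lt _ _ = contradiction lt (arc-q₀≮ {a} p p′ t t′ {c} {d} {c′} {d′} e)
  ... | tri> _ _ gt = contradiction gt (arc-q₀≮ {a} p′ p t′ t {c′} {d′} {c} {d}
          λ i< j< → let (to , from) = e i< j< in from , to)
  ... | tri≈ _ q₀≡ _ with q₀-injective {a} p p′ t t′ q₀≡
  ...   | refl , refl = cong₂ (arc p t)
            (label-injective c c′ (subst (λ N → label c ≐[ N ] label c′) inner-size (proj₁ both)))
            (label-injective d d′ (proj₂ both))
    where
    open Arc {a} {s} p t
    both = splits-≐⁻ (label-splits p t c d) (label-splits p t c′ d′)
      (subst (λ N → label (arc {a} p t c d) ≐[ N ] label (arc {a} p t c′ d′)) (sym total-size) e)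

  -- A connected labelling is coded or has too few classes for a tree.
  Decoding : ℕ → ℕ → (ℕ → ℕ) → Set
  Decoding a s f = (Σ (Code a s) λ c → f ≐[ size a s ] label c) ⊎
    (∃[ k ] Classes (size a s) k f × k + s < size a s)

  decoding-classes : ∀ {a s f} → Decoding a s f → ∃[ k ] Classes (size a s) k f × k + s ≤ size a s
  decoding-classes {a} {s} {f} (inj₁ (c , e)) = _ , classes-≐ e (label-classes c) , ℕ.≤-reflexive (weight+s≡size a s)
    where
    classes-≐ : ∀ {N k g} → f ≐[ N ] g → Classes N k g → Classes N k f
    classes-≐ e C = record { name = C.name ; name< = C.name< ; onto = C.onto
      ; same = λ i< j< → let (to , from) = e i< j< ; (to′ , from′) = C.same i< j< in
          to′ ∘ to , from ∘ from′ }
      where module C = Classes C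
  decoding-classes (inj₂ (k , C , lt)) = k , C , ℕ.<⇒≤ lt

  data FirstMatch (N : ℕ) (f : ℕ → ℕ) : Set where
    none  : (∀ {j} → j < N → f 0 ≢ f (suc j)) → FirstMatch N f
    first : ∀ {i} → i < N → f 0 ≡ f (suc i) → (∀ {j} → j < i → f 0 ≢ f (suc j)) → FirstMatch N f

  firstMatch : ∀ N f → FirstMatch N f
  firstMatch zero f = none λ ()
  firstMatch (suc N) f with firstMatch N f | f 0 ℕ.≟ f (suc N)
  ... | first i< e before | _ = first (ℕ.m<n⇒m<1+n i<) e before
  ... | none before | yes e = first ≤-refl e before
  ... | none before | no ≢ = none λ j< → case ℕ.m≤n⇒m<n∨m≡n (ℕ.≤-pred j<) of λ
        { (inj₁ lt) → before lt ; (inj₂ refl) → ≢ }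

  nonCrossing-tail : ∀ {f : ℕ → ℕ} → NonCrossingBelow (suc N) f → NonCrossingBelow N (f ∘ suc)
  nonCrossing-tail nc ab bc cd d< = nc (s≤s ab) (s≤s bc) (s≤s cd) (s≤s d<)

  Decodable : ℕ → Set
  Decodable s = ∀ a f → NonCrossingBelow (size a s) f → Connected a s f → Decoding a s f

  -- Each part has at most `s` intervals, so `rec` applies to it. Classes and intervals add up over
  -- the parts, hence a deficit on either side survives.
  decode-arc : ∀ {a s} → (∀ {t} → t < suc s → Decodable t) → ∀ (p : Fin ℓ) (t : Fin (suc s)) f →
    NonCrossingBelow (size (suc a) (suc s)) f → Connected (suc a) (suc s) f →
    f 0 ≡ f (Arc.q₀ {a} p t) → (∀ {i} → 0 < i → i < Arc.q₀ {a} p t → f 0 ≢ f i) → Decoding (suc a) (suc s) f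
  decode-arc {a} {s} rec p t f nc conn 0~q₀ least = combine
    (rec (Fin.toℕ<n t) _ f₁
      (subst (λ N → NonCrossingBelow N f₁) inner-size (inner-nonCrossing nc′ 0~q₀ least))
      (proj₁ (connected-split S conn)))
    (rec (s≤s (ℕ.m∸n≤m s (toℕ t))) _ f₂ (outer-nonCrossing nc′ 0~q₀ least) (proj₂ (connected-split S conn)))
    where
    open Arc {a} {s} p t
    f₁ = f ∘ ψ ∘ inj₁
    f₂ = f ∘ ψ ∘ inj₂
    nc′ : NonCrossingBelow total f
    nc′ = subst (λ N → NonCrossingBelow N f) (sym total-size) nc
    S : Splits f f₁ f₂
    S = splits-at-least nc′ 0~q₀ least
    count : ∀ {k₁ k₂} → Classes (size (toℕ p + a) (toℕ t)) k₁ f₁ → Classes K k₂ f₂ →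
      Classes (size (suc a) (suc s)) (k₁ + k₂) f
    count C₁ C₂ = classes-resize total-size
      (splits-classes S (classes-resize (sym inner-size) C₁) C₂)
    regroup : ∀ k₁ k₂ → (k₁ + toℕ t) + (k₂ + (s ∸ toℕ t)) ≡ (k₁ + k₂) + s
    regroup k₁ k₂ = trans (interchange k₁ (toℕ t) k₂ (s ∸ toℕ t)) (cong (k₁ + k₂ +_) t+u≡s)
      where
      interchange : ∀ a b c d → (a + b) + (c + d) ≡ (a + c) + (b + d)
      interchange = solve-∀
    sizes : size (toℕ p + a) (toℕ t) + K ≡ size a (suc s)
    sizes = trans (cong (_+ K) (sym inner-size)) (trans (swap (toℕ p) M K) (ℕ.suc-injective total-size))
      where
      swap : ∀ p M K → (p + M) + K ≡ M + (p + K)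
      swap = solve-∀
    finish : ∀ {k₁ k₂} → (k₁ + toℕ t) + (k₂ + (s ∸ toℕ t)) < size (toℕ p + a) (toℕ t) + K →
      k₁ + k₂ + suc s < size (suc a) (suc s)
    finish {k₁} {k₂} lt = subst (_< size (suc a) (suc s)) (sym (ℕ.+-suc (k₁ + k₂) s))
      (s≤s (subst (_≤ size a (suc s)) (cong suc (regroup k₁ k₂))
        (subst (suc ((k₁ + toℕ t) + (k₂ + (s ∸ toℕ t))) ≤_) sizes lt)))
    combine : Decoding (toℕ p + a) (toℕ t) f₁ → Decoding (ℓ ∸ toℕ p) (s ∸ toℕ t) f₂ → Decoding (suc a) (suc s) f
    combine (inj₁ (c , e₁)) (inj₁ (d , e₂)) = inj₁ (arc p t c d ,
      subst (λ N → f ≐[ N ] label (arc {a} p t c d)) total-size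
      (splits-≐ S (label-splits p t c d) (subst (λ N → f₁ ≐[ N ] label c) (sym inner-size) e₁) e₂))
    combine (inj₂ (k₁ , C₁ , lt)) D₂ = let (k₂ , C₂ , le) = decoding-classes D₂ in
      inj₂ (_ , count C₁ C₂ , finish {k₁} {k₂} (ℕ.+-mono-<-≤ lt le))
    combine D₁@(inj₁ _) (inj₂ (k₂ , C₂ , lt)) = let (k₁ , C₁ , le) = decoding-classes D₁ in
      inj₂ (_ , count C₁ C₂ , finish {k₁} {k₂} (ℕ.+-mono-≤-< le lt))

  -- The main induction is on the number of intervals, since an arc may enlarge the group to
  -- `p + a`; for a fixed number, removing 0 decreases `a`.
  decode : ∀ s → Decodable s
  decode = <-rec Decodable λ s rec a → go s rec a
    where
    go : ∀ s → (∀ {t} → t < s → Decodable t) → Decodable s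
    go zero rec zero f nc conn = inj₁ (nil , λ ())
    go (suc s) rec zero f nc conn = contradiction
      (conn (λ _ → false)
        (record { initial = λ () ; grouped = λ _ _ _ → refl ; respects = λ _ _ _ → refl }) {0} z<s) λ ()
    go s rec (suc a) f nc conn with firstMatch (size a s) f
    ... | none alone = skipped (go s rec a (f ∘ suc) (nonCrossing-tail nc)
            (connected-tail (λ j< e → contradiction e (alone j<)) conn))
      where
      skipped : Decoding a s (f ∘ suc) → Decoding (suc a) s f
      skipped (inj₁ (c , e)) = inj₁ (skip c , same)
        where
        same : f ≐[ size (suc a) s ] label (skip c)
        same {zero} {zero} _ _ = (λ _ → refl) , (λ _ → refl)
        same {zero} {suc j} _ (s≤s j<) = (λ e → contradiction e (alone j<)) , λ ()
        same {suc i} {zero} (s≤s i<) _ = (λ e → contradiction (sym e) (alone i<)) , λ ()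
        same {suc i} {suc j} (s≤s i<) (s≤s j<) = let (to , from) = e i< j< in
          cong suc ∘ to , from ∘ ℕ.suc-injective
      skipped (inj₂ (k , C , lt)) = inj₂ (suc k , classes-cons alone C , s≤s lt)
    ... | first {i} i< 0~i before with i <? a
    -- A neighbour within the group closes a cycle: dropping 0 loses a point but no class, so there
    -- are too few classes for a tree.
    ...   | yes i<a = let (k , C , le) = decoding-classes (go s rec a (f ∘ suc) (nonCrossing-tail nc)
                            (connected-tail (λ _ _ → i , i<a , 0~i) conn)) in
            inj₂ (k , classes-duplicate i< 0~i C , s≤s le)
    ...   | no i≮a with i ∸ a | ℕ.m+[n∸m]≡n (ℕ.≮⇒≥ i≮a)
    go zero rec (suc a) f nc conn | first i< 0~i before | no _ | z | refl = contradiction (ℕ.+-cancelˡ-< a _ _ i<) λ ()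
    go (suc s) rec (suc a) f nc conn | first i< 0~i before | no _ | z | refl =
      decode-arc rec p t f nc conn (trans 0~i (cong f (sym q₀≡)))
        λ { {suc j} _ j< → before (ℕ.≤-pred (subst (suc j <_) q₀≡ j<)) }
      where
      z< : z < suc s * ℓ
      z< = ℕ.+-cancelˡ-< a _ _ i<
      p = fromℕ< (m%n<n z ℓ)
      t = fromℕ< (m<n*o⇒m/o<n z<)
      q₀≡ : Arc.q₀ {a} p t ≡ suc (a + z)
      q₀≡ = cong suc (trans (ℕ.+-assoc a _ _) (cong (a +_) (trans
        (cong₂ (λ u v → u * ℓ + (v + 0)) (Fin.toℕ-fromℕ< (m<n*o⇒m/o<n z<)) (Fin.toℕ-fromℕ< (m%n<n z ℓ)))
        (trans (trans (cong (z / ℓ * ℓ +_) (ℕ.+-identityʳ (z % ℓ))) (ℕ.+-comm (z / ℓ * ℓ) (z % ℓ)))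
          (sym (m≡m%n+[m/n]*n z ℓ))))))

-- The number of codes

sumFin : ∀ n → (Fin n → ℕ) → ℕ
sumFin zero f = 0
sumFin (suc n) f = f zero + sumFin n (f ∘ suc)

sumFin-cong : ∀ n {f g : Fin n → ℕ} → (∀ i → f i ≡ g i) → sumFin n f ≡ sumFin n g
sumFin-cong zero e = refl
sumFin-cong (suc n) e = cong₂ _+_ (e zero) (sumFin-cong n (e ∘ suc))

sumFin-const : ∀ n c → sumFin n (λ _ → c) ≡ n * c
sumFin-const zero c = refl
sumFin-const (suc n) c = cong (_+_ c) (sumFin-const n c)

sumFin-+ : ∀ n (f g : Fin n → ℕ) k → sumFin n (λ i → f i + k * g i) ≡ sumFin n f + k * sumFin n g
sumFin-+ zero f g k = sym (ℕ.*-zeroʳ k)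
sumFin-+ (suc n) f g k = trans (cong (f zero + k * g zero +_) (sumFin-+ n (f ∘ suc) (g ∘ suc) k))
  (regroup (f zero) (g zero) k _ _)
  where
  regroup : ∀ a b k c d → (a + k * b) + (c + k * d) ≡ (a + c) + k * (b + d)
  regroup = solve-∀

sumFin-↔ : ∀ n (f : Fin n → ℕ) → Fin (sumFin n f) ↔ Σ (Fin n) (Fin ∘ f)
sumFin-↔ zero f = mk↔ₛ′ (λ ()) (λ ()) (λ ()) (λ ())
sumFin-↔ (suc n) f = unsplit ↔-∘ ((↔-id _ ⊎-↔ sumFin-↔ n (f ∘ suc)) ↔-∘ Fin.+↔⊎)
  where
  unsplit : (Fin (f zero) ⊎ Σ (Fin n) (Fin ∘ f ∘ suc)) ↔ Σ (Fin (suc n)) (Fin ∘ f)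
  unsplit = mk↔ₛ′ (λ { (inj₁ x) → zero , x ; (inj₂ (i , x)) → suc i , x })
    (λ { (zero , x) → inj₁ x ; (suc i , x) → inj₂ (i , x) })
    (λ { (zero , x) → refl ; (suc i , x) → refl })
    (λ { (inj₁ x) → refl ; (inj₂ (i , x)) → refl })

-- Identities for binomial coefficients

nC0≡1 : ∀ n → n Comb.C 0 ≡ 1
nC0≡1 n = trans (Comb.nCk≡nC[n∸k] {0} {n} z≤n) (Comb.nCn≡1 n)

[k+1]*[n+1]C[k+1]≡[n+1]*nCk : ∀ n k → suc k * (suc n Comb.C suc k) ≡ suc n * (n Comb.C k)
[k+1]*[n+1]C[k+1]≡[n+1]*nCk zero zero = refl
[k+1]*[n+1]C[k+1]≡[n+1]*nCk zero (suc k) = trans (cong (suc (suc k) *_) (Comb.k>n⇒nCk≡0 {1} {2 + k} (s≤s (s≤s z≤n))))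
  (trans (ℕ.*-zeroʳ (suc (suc k))) (cong (1 *_) (sym (Comb.k>n⇒nCk≡0 {0} {suc k} (s≤s z≤n)))))
[k+1]*[n+1]C[k+1]≡[n+1]*nCk (suc n) zero = begin
  1 * (suc (suc n) Comb.C 1)         ≡⟨ cong (1 *_) (Comb.nCk+nC[k+1]≡[n+1]C[k+1] (suc n) 0) ⟨
  1 * (suc n Comb.C 0 + suc n Comb.C 1)   ≡⟨ ℕ.*-distribˡ-+ 1 (suc n Comb.C 0) (suc n Comb.C 1) ⟩
  1 * (suc n Comb.C 0) + 1 * (suc n Comb.C 1)
    ≡⟨ cong₂ (λ x y → 1 * x + y) (nC0≡1 (suc n)) ([k+1]*[n+1]C[k+1]≡[n+1]*nCk n 0) ⟩
  1 + suc n * (n Comb.C 0)           ≡⟨ cong (λ x → 1 + suc n * x) (nC0≡1 n) ⟩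
  1 + suc n * 1                 ≡⟨⟩
  suc (suc n) * 1               ≡⟨ cong (suc (suc n) *_) (nC0≡1 (suc n)) ⟨
  suc (suc n) * (suc n Comb.C 0)     ∎
  where open ≡-Reasoning
[k+1]*[n+1]C[k+1]≡[n+1]*nCk (suc n) (suc k) = begin
  (2 + k) * (suc (suc n) Comb.C (2 + k))
    ≡⟨ cong ((2 + k) *_) (Comb.nCk+nC[k+1]≡[n+1]C[k+1] (suc n) (suc k)) ⟨
  (2 + k) * (X + suc n Comb.C (2 + k))                  ≡⟨ expand k X _ ⟩
  X + (suc k * X + (2 + k) * (suc n Comb.C (2 + k)))
    ≡⟨ cong₂ (λ x y → X + (x + y)) ([k+1]*[n+1]C[k+1]≡[n+1]*nCk n k)
         ([k+1]*[n+1]C[k+1]≡[n+1]*nCk n (suc k)) ⟩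
  X + (suc n * (n Comb.C k) + suc n * (n Comb.C suc k))
    ≡⟨ cong (X +_) (ℕ.*-distribˡ-+ (suc n) (n Comb.C k) (n Comb.C suc k)) ⟨
  X + suc n * (n Comb.C k + n Comb.C suc k)
    ≡⟨ cong (λ x → X + suc n * x) (Comb.nCk+nC[k+1]≡[n+1]C[k+1] n k) ⟩
  suc (suc n) * X                                  ∎
  where
  open ≡-Reasoning
  X = suc n Comb.C suc k
  expand : ∀ k x y → (2 + k) * (x + y) ≡ x + (suc k * x + (2 + k) * y)
  expand = solve-∀

-- The ratio of neighbours in a row of the Pascal triangle, written without subtraction.
[k+1]*nC[k+1]+k*nCk≡n*nCk : ∀ n k → suc k * (n Comb.C suc k) + k * (n Comb.C k) ≡ n * (n Comb.C k)
[k+1]*nC[k+1]+k*nCk≡n*nCk n k = ℕ.+-cancelˡ-≡ (n Comb.C k) _ _ (begin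
  n Comb.C k + (suc k * (n Comb.C suc k) + k * (n Comb.C k)) ≡⟨ collect k (n Comb.C k) (n Comb.C suc k) ⟩
  suc k * (n Comb.C k + n Comb.C suc k)
    ≡⟨ cong (suc k *_) (Comb.nCk+nC[k+1]≡[n+1]C[k+1] n k) ⟩
  suc k * (suc n Comb.C suc k)                     ≡⟨ [k+1]*[n+1]C[k+1]≡[n+1]*nCk n k ⟩
  suc n * (n Comb.C k)                             ∎)
  where
  open ≡-Reasoning
  collect : ∀ k x y → x + (suc k * y + k * x) ≡ suc k * (x + y)
  collect = solve-∀

module Counting (l : ℕ) where
  open Codes l

  -- The number of codes, with the two subcodes of an arc joined into one that starts
  -- with a group of (p + a) + (ℓ − p) points.
  count : ℕ → ℕ → ℕ
  count zero a = 1
  count (suc s) zero = 0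
  count (suc s) (suc a) = count (suc s) a + ℓ * count s (a + ℓ)

  -- If F is the series with coefficients `count s 1`, the recursion reads F^(a+1) = F^a + ℓ x
  -- F^(a+ℓ), so `count s a` is a coefficient of F^a. The identity is F^a F^b = F^(a+b).
  convolution : ∀ s a b → sumFin (suc s) (λ t → count (toℕ t) a * count (s ∸ toℕ t) b) ≡ count s (a + b)
  convolution zero a b = refl
  convolution (suc s) zero b = trans (cong (1 * count (suc s) b +_)
      (trans (sumFin-const (suc s) 0) (ℕ.*-zeroʳ (suc s))))
    (trans (ℕ.+-identityʳ _) (ℕ.*-identityˡ _))
  convolution (suc s) (suc a) b = begin
    H + sumFin (suc s) (λ t → (count (suc (toℕ t)) a + ℓ * count (toℕ t) (a + ℓ)) * G t)
      ≡⟨ cong (H +_) (sumFin-cong (suc s) λ t → distribute (count (suc (toℕ t)) a) ℓ (count (toℕ t) (a + ℓ)) (G t)) ⟩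
    H + sumFin (suc s) (λ t → count (suc (toℕ t)) a * G t + ℓ * (count (toℕ t) (a + ℓ) * G t))
      ≡⟨ cong (H +_) (sumFin-+ (suc s) (λ t → count (suc (toℕ t)) a * G t) (λ t → count (toℕ t) (a + ℓ) * G t) ℓ) ⟩
    H + (sumFin (suc s) (λ t → count (suc (toℕ t)) a * G t) + ℓ * sumFin (suc s) (λ t → count (toℕ t) (a + ℓ) * G t))
      ≡⟨ ℕ.+-assoc H _ _ ⟨
    (H + sumFin (suc s) (λ t → count (suc (toℕ t)) a * G t)) + ℓ * sumFin (suc s) (λ t → count (toℕ t) (a + ℓ) * G t)
      ≡⟨ cong₂ (λ x y → x + ℓ * y) (convolution (suc s) a b) (convolution s (a + ℓ) b) ⟩
    count (suc s) (a + b) + ℓ * count s (a + ℓ + b)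
      ≡⟨ cong (λ x → count (suc s) (a + b) + ℓ * count s x) (swap a ℓ b) ⟩
    count (suc s) (a + b) + ℓ * count s (a + b + ℓ) ∎
    where
    open ≡-Reasoning
    G : Fin (suc s) → ℕ
    G t = count (s ∸ toℕ t) b
    H = 1 * count (suc s) b
    distribute : ∀ x k y z → (x + k * y) * z ≡ x * z + k * (y * z)
    distribute = solve-∀
    swap : ∀ a k b → a + k + b ≡ a + b + k
    swap = solve-∀

  arcs : ℕ → ℕ → ℕ
  arcs s a = sumFin ℓ λ p → sumFin (suc s) λ t → count (toℕ t) (toℕ p + a) * count (s ∸ toℕ t) (ℓ ∸ toℕ p)

  -- After convolution the contribution of `p` depends only on `(p + a) + (ℓ ∸ p)`, the same for all
  -- `ℓ` choices.
  arcs≡ : ∀ s a → arcs s a ≡ ℓ * count s (a + ℓ)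
  arcs≡ s a = trans (sumFin-cong ℓ λ p → trans (convolution s (toℕ p + a) (ℓ ∸ toℕ p))
    (cong (count s) (trans (swap (toℕ p) a (ℓ ∸ toℕ p)) (cong (_+_ a) (ℕ.m+[n∸m]≡n (ℕ.<⇒≤ (Fin.toℕ<n p)))))))
    (sumFin-const ℓ _)
    where
    swap : ∀ p a q → p + a + q ≡ a + (p + q)
    swap = solve-∀

  enumerate : ∀ s a → Fin (count s a) ↔ Code a s
  enumerate = <-rec (λ s → ∀ a → Fin (count s a) ↔ Code a s) λ s rec a → go s rec a
    where
    go : ∀ s → (∀ {t} → t < s → ∀ a → Fin (count t a) ↔ Code a t) → ∀ a → Fin (count s a) ↔ Code a s
    go zero rec zero = mk↔ₛ′ (λ _ → nil) (λ _ → zero) (λ { nil → refl }) (λ { zero → refl })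
    go zero rec (suc a) = mk↔ₛ′ skip (λ { (skip c) → c }) (λ { (skip c) → refl }) (λ _ → refl) ↔-∘ go zero rec a
    go (suc s) rec zero = mk↔ₛ′ (λ ()) (λ ()) (λ ()) (λ ())
    go (suc s) rec (suc a) = assemble ↔-∘ ((go (suc s) rec a ⊎-↔ (arcCodes ↔-∘ cast (sym (arcs≡ s a)))) ↔-∘ Fin.+↔⊎)
      where
      Arcs : Set
      Arcs = Σ (Fin ℓ) λ p → Σ (Fin (suc s)) λ t → Code (toℕ p + a) (toℕ t) × Code (ℓ ∸ toℕ p) (s ∸ toℕ t)
      cast : ∀ {m n} → m ≡ n → Fin m ↔ Fin n
      cast refl = ↔-id _
      arcCodes : Fin (arcs s a) ↔ Arcs
      arcCodes = Σ-↔ (↔-id _) (λ {p} → Σ-↔ (↔-id _) (λ {t} →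
          (rec (Fin.toℕ<n t) _ ×-↔ rec (s≤s (ℕ.m∸n≤m s (toℕ t))) _) ↔-∘ Fin.*↔×)
          ↔-∘ sumFin-↔ (suc s) _)
        ↔-∘ sumFin-↔ ℓ _
      assemble : (Code a (suc s) ⊎ Arcs) ↔ Code (suc a) (suc s)
      assemble = mk↔ₛ′ (λ { (inj₁ c) → skip c ; (inj₂ (p , t , c , d)) → arc p t c d })
        (λ { (skip c) → inj₁ c ; (arc p t c d) → inj₂ (p , t , c , d) })
        (λ { (skip c) → refl ; (arc p t c d) → refl })
        (λ { (inj₁ c) → refl ; (inj₂ (p , t , c , d)) → refl })

  -- The Raney numbers a / (a + sℓ) · C(a + sℓ, s), scaled by ℓ ^ s.
  count-closed : ∀ s a → size a s * count s a ≡ a * ℓ ^ s * (size a s Comb.C s)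
  count-closed zero a = trans (cong (_* 1) (ℕ.+-identityʳ a))
    (sym (cong₂ _*_ (ℕ.*-identityʳ a) (nC0≡1 (a + 0))))
  count-closed (suc s) zero = ℕ.*-zeroʳ (size 0 (suc s))
  count-closed (suc s) (suc a) = ℕ.*-cancelˡ-≡ _ _ pts ⦃ pts≢0 ⦄ (begin
    pts * (suc pts * (A₁ + ℓ * A₂))
      ≡⟨ spread pts A₁ ℓ A₂ ⟩
    suc pts * (pts * A₁ + ℓ * (pts * A₂))
      ≡⟨ cong₂ (λ x y → suc pts * (x + ℓ * y)) (count-closed (suc s) a) IH₂ ⟩
    suc pts * (a * (ℓ * L) * Y + ℓ * ((a + ℓ) * L * X))
      ≡⟨ factor pts a ℓ L X Y ⟩
    ℓ * L * (suc pts * (a * Y + (a + ℓ) * X))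
      ≡⟨ cong (ℓ * L *_) core ⟩
    ℓ * L * (pts * suc a * (X + Y))
      ≡⟨ cong (λ z → ℓ * L * (pts * suc a * z)) (Comb.nCk+nC[k+1]≡[n+1]C[k+1] pts s) ⟩
    ℓ * L * (pts * suc a * (suc pts Comb.C suc s))
      ≡⟨ reorder ℓ L pts a _ ⟩
    pts * (suc a * (ℓ * L) * (suc pts Comb.C suc s)) ∎)
    where
    open ≡-Reasoning
    -- This is also `size (a + ℓ) s`, so multiplying by `pts` makes both induction hypotheses
    -- applicable.
    pts = size a (suc s)
    pts≢0 : NonZero pts
    pts≢0 = subst NonZero (sym (ℕ.+-suc a _)) _
    A₁ = count (suc s) a
    A₂ = count s (a + ℓ)
    L = ℓ ^ s
    X = pts Comb.C s
    Y = pts Comb.C suc s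
    IH₂ : pts * A₂ ≡ (a + ℓ) * L * X
    IH₂ = subst (λ pts → pts * A₂ ≡ (a + ℓ) * L * (pts Comb.C s)) (ℕ.+-assoc a ℓ (s * ℓ)) (count-closed s (a + ℓ))
    spread : ∀ pts x k y → pts * (suc pts * (x + k * y)) ≡ suc pts * (pts * x + k * (pts * y))
    spread = solve-∀
    factor : ∀ pts a k L X Y →
      suc pts * (a * (k * L) * Y + k * ((a + k) * L * X)) ≡ k * L * (suc pts * (a * Y + (a + k) * X))
    factor = solve-∀
    reorder : ∀ k L pts a z → k * L * (pts * suc a * z) ≡ pts * (suc a * (k * L) * z)
    reorder = solve-∀
    left : ∀ a s k X Y → let pts = a + suc s * k in
      suc pts * (a * Y + (a + k) * X) + s * k * X ≡ pts * a * (X + Y) + a * Y + pts * X + pts * k * X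
    left = solve-∀
    right : ∀ a s k X Y → let pts = a + suc s * k in
      pts * suc a * (X + Y) + s * k * X ≡ pts * a * (X + Y) + a * Y + pts * X + k * (suc s * Y + s * X)
    right = solve-∀
    core : suc pts * (a * Y + (a + ℓ) * X) ≡ pts * suc a * (X + Y)
    -- The added term avoids subtraction; both sides then differ by `ℓ` times the identity for the
    -- ratio of `X` and `Y`.
    core = ℕ.+-cancelʳ-≡ (s * ℓ * X) _ _ (begin
      suc pts * (a * Y + (a + ℓ) * X) + s * ℓ * X ≡⟨ left a s ℓ X Y ⟩
      pts * a * (X + Y) + a * Y + pts * X + pts * ℓ * X ≡⟨ cong (pts * a * (X + Y) + a * Y + pts * X +_)
         (trans (commute pts ℓ X) (cong (ℓ *_) (sym ([k+1]*nC[k+1]+k*nCk≡n*nCk pts s)))) ⟩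
      pts * a * (X + Y) + a * Y + pts * X + ℓ * (suc s * Y + s * X) ≡⟨ right a s ℓ X Y ⟨
      pts * suc a * (X + Y) + s * ℓ * X ∎)
      where
      commute : ∀ pts k x → pts * k * x ≡ k * (pts * x)
      commute = solve-∀

  -- For a group of `ℓ` points the factor `a / size` of the Raney number is `1 / (m + 1)`, and the
  -- ratio of neighbouring binomials leads from `C(pts, m)` to `C(pts, m + 1)`.
  count-FCat : ∀ m → let pts = ℓ * suc m in
    count m ℓ * suc (l * suc m) ≡ (pts Comb.C suc m) * ℓ ^ m
  count-FCat m = ℕ.*-cancelˡ-≡ _ _ (suc m) (begin
    suc m * (count m ℓ * suc (l * suc m)) ≡⟨ ℕ.*-assoc (suc m) (count m ℓ) _ ⟨
    suc m * count m ℓ * suc (l * suc m)   ≡⟨ cong (_* suc (l * suc m)) m*count ⟩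
    ℓ ^ m * X * suc (l * suc m)           ≡⟨ swap (ℓ ^ m) X (suc (l * suc m)) ⟩
    ℓ ^ m * (suc (l * suc m) * X)         ≡⟨ cong (ℓ ^ m *_) Y≡ ⟨
    ℓ ^ m * (suc m * Y)                   ≡⟨ swap′ (ℓ ^ m) (suc m) Y ⟩
    suc m * (Y * ℓ ^ m)                   ∎)
    where
    open ≡-Reasoning
    pts = ℓ * suc m
    X = pts Comb.C m
    Y = pts Comb.C suc m
    swap : ∀ a b c → a * b * c ≡ a * (c * b)
    swap = solve-∀
    swap′ : ∀ a b c → a * (b * c) ≡ b * (c * a)
    swap′ = solve-∀
    m*count : suc m * count m ℓ ≡ ℓ ^ m * X
    m*count = ℕ.*-cancelˡ-≡ _ _ ℓ (begin
      ℓ * (suc m * count m ℓ)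
        ≡⟨ trans (sym (ℕ.*-assoc ℓ (suc m) (count m ℓ))) (cong (_* count m ℓ) (ℕ.*-comm ℓ (suc m))) ⟩
      size ℓ m * count m ℓ ≡⟨ count-closed m ℓ ⟩
      ℓ * ℓ ^ m * (size ℓ m Comb.C m) ≡⟨ cong (λ z → ℓ * ℓ ^ m * (z Comb.C m)) (ℕ.*-comm (suc m) ℓ) ⟩
      ℓ * ℓ ^ m * X ≡⟨ ℕ.*-assoc ℓ (ℓ ^ m) X ⟩
      ℓ * (ℓ ^ m * X) ∎)
    Y≡ : suc m * Y ≡ suc (l * suc m) * X
    Y≡ = ℕ.+-cancelʳ-≡ (m * X) _ _ (trans ([k+1]*nC[k+1]+k*nCk≡n*nCk pts m) (split l m X))
      where
      split : ∀ l m X → suc l * suc m * X ≡ suc (l * suc m) * X + m * X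
      split = solve-∀

fromℕ≡FCat* : ∀ {N k} c d → N * suc d ≡ c * k → fromℕ N ≡ (ℤ.+ c ℚ./ suc d) ℚ.* fromℕ k
fromℕ≡FCat* {N} {k} c d e = ℚ.toℚᵘ-injective (ℚᵘ.≃-trans (ℚ.toℚᵘ-fromℚᵘ (mkℚᵘ (ℤ.+ N) 0))
  (ℚᵘ.≃-sym (ℚᵘ.≃-trans (ℚ.toℚᵘ-homo-* (ℤ.+ c ℚ./ suc d) (fromℕ k))
    (ℚᵘ.≃-trans (ℚᵘ.*-cong (ℚ.toℚᵘ-fromℚᵘ (mkℚᵘ (ℤ.+ c) d)) (ℚ.toℚᵘ-fromℚᵘ (mkℚᵘ (ℤ.+ k) 0)))
      (*≡* cross)))))
  where
  open ≡-Reasoning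
  cross : (ℤ.+ c ℤ.* ℤ.+ k) ℤ.* ℤ.+ 1 ≡ ℤ.+ N ℤ.* (ℤ.+ suc (d * 1))
  cross = begin
    (ℤ.+ c ℤ.* ℤ.+ k) ℤ.* ℤ.+ 1 ≡⟨ ℤ.*-identityʳ _ ⟩
    ℤ.+ c ℤ.* ℤ.+ k ≡⟨ ℤ.pos-* c k ⟨
    ℤ.+ (c * k) ≡⟨ cong ℤ.+_ e ⟨
    ℤ.+ (N * suc d) ≡⟨ cong (λ z → ℤ.+ (N * suc z)) (ℕ.*-identityʳ d) ⟨
    ℤ.+ (N * suc (d * 1)) ≡⟨ ℤ.pos-* N _ ⟩
    ℤ.+ N ℤ.* ℤ.+ suc (d * 1) ∎

-- Meandric partners of the interval partition

module Interval (l m : ℕ) where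
  open Codes l
  open Counting l

  Λ : NC (ℓ * suc m)
  Λ = λ-interval ℓ (suc m)

  -- Chosen so that `ℓ * suc m` computes to `suc last`.
  last : ℕ
  last = m + l * suc m

  private
    index : Fin (suc last) → Fin (suc m)
    index x = proj₁ (proj₁ (proj₂ (Partition.cover (proj₁ Λ) x)))

    block≡interval : ∀ x → blockOf Λ x ≡ interval ℓ (suc m) (index x)
    block≡interval x = proj₂ (proj₁ (proj₂ (Partition.cover (proj₁ Λ) x)))

    ∈index : ∀ x → InInterval ℓ (suc m) (index x) x
    ∈index x = ∈-interval⁻ ℓ (suc m) (index x) (subst (x ∈_) (block≡interval x) (∈-blockOf Λ {x} {x} refl))

  Λ-lab⁺ : ∀ {k x y} → InInterval ℓ (suc m) k x → InInterval ℓ (suc m) k y → lab Λ x ≡ lab Λ y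
  Λ-lab⁺ {k} x∈ y∈ = block≼lab Λ (trans (sym (blockOf-unique Λ (k , refl) (∈-interval⁺ ℓ (suc m) k x∈)))
    (blockOf-unique Λ (k , refl) (∈-interval⁺ ℓ (suc m) k y∈)))

  Λ-lab⁻ : ∀ {x y} → lab Λ x ≡ lab Λ y → InInterval ℓ (suc m) (index x) y
  Λ-lab⁻ {x} {y} e = ∈-interval⁻ ℓ (suc m) (index x)
    (subst (y ∈_) (block≡interval x) (∈-blockOf Λ {x} {y} (lab≼block Λ {x} {y} e)))

  convex : ∀ {x w y} → x Fin.< w → w Fin.< y → lab Λ x ≡ lab Λ y → lab Λ w ≡ lab Λ x
  convex {x} {w} {y} x<w w<y e = Λ-lab⁺ {index x}
    (ℕ.≤-trans (proj₁ (∈index x)) (ℕ.<⇒≤ x<w) , ℕ.<-trans w<y (proj₂ (Λ-lab⁻ e))) (∈index x)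

  #Λ : # Λ ≡ suc m
  #Λ = #-unique Λ {f = index} onto
    (λ {x} {y} e → Λ-lab⁺ {index x} (∈index x) (subst (λ k → InInterval ℓ (suc m) k y) (sym e) (∈index y)))
    (λ {x} {y} e → interval-unique ℓ (suc m) (index x) (index y) (Λ-lab⁻ e) (∈index y))
    where
    onto : Onto index
    onto k = let (x , x∈) = Partition.nonempty (proj₁ Λ) {interval ℓ (suc m) k} (k , refl) in
      x , interval-unique ℓ (suc m) (index x) k (∈index x) (∈-interval⁻ ℓ (suc m) k x∈)

  open Partner Λ convex renaming (Connected to ConnectedWithΛ)

  -- The first of the `m + 1` intervals serves as the initial group, which leaves `m` intervals.
  size≡ : size ℓ m ≡ suc last
  size≡ = ℕ.*-comm (suc m) ℓ

  fin : ℕ → Fin (suc last)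
  fin i with i <? suc last
  ... | yes i< = fromℕ< i<
  ... | no _   = zero

  toℕ-fin : ∀ {i} → i < size ℓ m → toℕ (fin i) ≡ i
  toℕ-fin {i} i<′ with i <? suc last
  ... | yes i< = Fin.toℕ-fromℕ< i<
  ... | no i≮ = contradiction (subst (i <_) size≡ i<′) i≮

  toℕ< : (x : Fin (suc last)) → toℕ x < size ℓ m
  toℕ< x = subst (toℕ x <_) (sym size≡) (Fin.toℕ<n x)

  fin-toℕ : ∀ x → fin (toℕ x) ≡ x
  fin-toℕ x = Fin.toℕ-injective (toℕ-fin (toℕ< x))

  #-classes : (ρ : NC (suc last)) {f : ℕ → ℕ} → f ∘ toℕ ≼ lab ρ → lab ρ ≼ f ∘ toℕ →
    ∀ {k} → Classes (size ℓ m) k f → # ρ ≡ k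
  #-classes ρ {f} f≼ρ ρ≼f {k} C = #-unique ρ {f = name′} name-onto
    (λ {x} {y} e → f≼ρ (proj₂ (same (toℕ< x) (toℕ< y))
      (trans (sym (Fin.toℕ-fromℕ< (name< (toℕ< x)))) (trans (cong toℕ e) (Fin.toℕ-fromℕ< (name< (toℕ< y)))))))
    (λ {x} {y} e → Fin.fromℕ<-cong _ _ (proj₁ (same (toℕ< x) (toℕ< y)) (ρ≼f e)) _ _)
    where
    open Classes C
    name′ : Fin (suc last) → Fin k
    name′ x = fromℕ< (name< (toℕ< x))
    name-onto : Onto name′
    name-onto c = let (i , i< , e) = onto (Fin.toℕ<n c) in fin i , Fin.toℕ-injective
      (trans (Fin.toℕ-fromℕ< _) (trans (cong name (toℕ-fin i<)) e))

  weight-count : suc m + weight ℓ m ≡ suc (suc last)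
  weight-count = cong suc (trans (ℕ.+-comm m (weight ℓ m)) (trans (weight+s≡size ℓ m) size≡))

  module _ (c : Code ℓ m) where

    codeLabel : Fin (suc last) → ℕ
    codeLabel = label c ∘ toℕ

    codeLabel-nonCrossing : NonCrossingLabel codeLabel
    codeLabel-nonCrossing a<b b<c c<d e e′ = label-nonCrossing c a<b b<c c<d (toℕ< _) e e′

    codePartition : NC (suc last)
    codePartition = fromLabel ℕ._≟_ codeLabel codeLabel-nonCrossing

    label≼ : codeLabel ≼ lab codePartition
    label≼ = lab-fromLabel⁺ ℕ._≟_ codeLabel codeLabel-nonCrossing

    ≼label : lab codePartition ≼ codeLabel
    ≼label = lab-fromLabel⁻ ℕ._≟_ codeLabel codeLabel-nonCrossing

    codePartition-connected : ConnectedWithΛ codePartition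
    codePartition-connected χ Λ≼χ ρ≼χ x y = trans (all x) (sym (all y))
      where
      -- Comparing with the colour of point `zero` normalises the colour of the initial group to
      -- `true`.
      χ₀ : ℕ → Bool
      χ₀ i = does (χ (fin i) ≟ᵇ χ zero)
      χ₀-cong : ∀ {i j} → χ (fin i) ≡ χ (fin j) → χ₀ i ≡ χ₀ j
      χ₀-cong = cong (λ b → does (b ≟ᵇ χ zero))
      group : ∀ k {i j} → k < suc m → k * ℓ + i < size ℓ m → k * ℓ + j < size ℓ m → i < ℓ → j < ℓ →
        χ (fin (k * ℓ + i)) ≡ χ (fin (k * ℓ + j))
      group k {i} {j} k< i<N j<N i< j< = Λ≼χ (Λ-lab⁺ {fromℕ< k<} (member i<N i<) (member j<N j<))
        where
        member : ∀ {i} → k * ℓ + i < size ℓ m → i < ℓ → InInterval ℓ (suc m) (fromℕ< k<) (fin (k * ℓ + i))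
        member {i} i<N i< rewrite toℕ-fin i<N | Fin.toℕ-fromℕ< k< =
          ℕ.m≤m+n (k * ℓ) i , subst (k * ℓ + i <_) (ℕ.+-comm (k * ℓ) ℓ) (ℕ.+-monoʳ-< (k * ℓ) i<)
      bound : ∀ {k i} → k < suc m → i < ℓ → k * ℓ + i < size ℓ m
      bound {k} {i} k< i< = ℕ.<-≤-trans
        (subst (k * ℓ + i <_) (ℕ.+-comm (k * ℓ) ℓ) (ℕ.+-monoʳ-< (k * ℓ) i<)) (ℕ.*-monoˡ-≤ ℓ k<)
      shift : ∀ k x → ℓ + (k * ℓ + x) ≡ suc k * ℓ + x
      shift k x = sym (ℕ.+-assoc ℓ (k * ℓ) x)
      closed : Closed ℓ m (label c) χ₀
      closed = record
        { initial = λ {i} i< → trans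
            (χ₀-cong {i} {0} (group 0 z<s (bound {0} {i} z<s i<) (bound {0} {0} z<s z<s) i< z<s))
            (dec-true (χ (fin 0) ≟ᵇ χ zero) (cong χ (fin-toℕ zero)))
        ; grouped = λ {k} {x} {y} k< x< y< → χ₀-cong {ℓ + (k * ℓ + x)} {ℓ + (k * ℓ + y)}
            (trans (cong (χ ∘ fin) (shift k x))
              (trans (group (suc k) (s≤s k<) (bound {suc k} {x} (s≤s k<) x<) (bound {suc k} {y} (s≤s k<) y<) x< y<)
                (cong (χ ∘ fin) (sym (shift k y)))))
        ; respects = λ {i} {j} i< j< e → χ₀-cong {i} {j} (ρ≼χ (label≼ {fin i} {fin j}
            (trans (cong (label c) (toℕ-fin i<)) (trans e (cong (label c) (sym (toℕ-fin j<)))))))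
        }
      all : ∀ x → χ x ≡ χ zero
      all x with χ (fin (toℕ x)) ≟ᵇ χ zero | label-connected c χ₀ closed (toℕ< x)
      ... | yes e | _ = trans (cong χ (sym (fin-toℕ x))) e
      ... | no _  | ()

    codePartition-partner : MeandricPartner Λ codePartition
    codePartition-partner = ⇒partner codePartition (trans (cong₂ _+_ #Λ
      (#-classes codePartition label≼ ≼label (label-classes c))) weight-count) codePartition-connected

  labelℕ : NC (suc last) → ℕ → ℕ
  labelℕ ρ = toℕ ∘ lab ρ ∘ fin

  labelℕ-nonCrossing : ∀ ρ → NonCrossingBelow (size ℓ m) (labelℕ ρ)
  labelℕ-nonCrossing ρ {a} {b} {c} {d} a<b b<c c<d d< e e′ = cong toℕ (lab-nonCrossing ρ
      (up a< b< a<b) (up b< c< b<c) (up c< d< c<d) (Fin.toℕ-injective e) (Fin.toℕ-injective e′))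
    where
    c< = ℕ.<-trans c<d d<
    b< = ℕ.<-trans b<c c<
    a< = ℕ.<-trans a<b b<
    up : ∀ {i j} → i < size ℓ m → j < size ℓ m → i < j → fin i Fin.< fin j
    up i< j< lt rewrite toℕ-fin i< | toℕ-fin j< = lt

  labelℕ-connected : ∀ ρ → ConnectedWithΛ ρ → Connected ℓ m (labelℕ ρ)
  labelℕ-connected ρ conn χ C {i} i< = trans (cong χ (sym (toℕ-fin i<)))
    (trans (conn (χ ∘ toℕ) (λ {x} {y} e → same-group {index x} {x} {y} (∈index x) (Λ-lab⁻ {x} {y} e))
        ρ≼χ (fin i) zero) (C.initial z<s))
    where
    module C = Closed C
    same-group : ∀ {k x y} → InInterval ℓ (suc m) k x → InInterval ℓ (suc m) k y → χ (toℕ x) ≡ χ (toℕ y)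
    same-group {zero} {x} {y} (_ , x<) (_ , y<) = trans (C.initial (subst (toℕ x <_) (ℕ.+-identityʳ ℓ) x<))
      (sym (C.initial (subst (toℕ y <_) (ℕ.+-identityʳ ℓ) y<)))
    same-group {suc k} {x} {y} (≤x , x<) (≤y , y<)
      with toℕ x ∸ suc (toℕ k) * ℓ | ℕ.m+[n∸m]≡n ≤x | toℕ y ∸ suc (toℕ k) * ℓ | ℕ.m+[n∸m]≡n ≤y
    ... | u | eu | v | ev = trans (cong χ (shift eu))
          (trans (C.grouped (Fin.toℕ<n k) (small eu x<) (small ev y<)) (sym (cong χ (shift ev))))
      where
      shift : ∀ {u z} → suc (toℕ k) * ℓ + u ≡ z → z ≡ ℓ + (toℕ k * ℓ + u)
      shift {u} e = trans (sym e) (ℕ.+-assoc ℓ (toℕ k * ℓ) u)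
      small : ∀ {u z} → suc (toℕ k) * ℓ + u ≡ z → z < suc (suc (toℕ k)) * ℓ → u < ℓ
      small {u} refl lt = ℕ.+-cancelˡ-< (suc (toℕ k) * ℓ) u ℓ
        (subst (suc (toℕ k) * ℓ + u <_) (ℕ.+-comm ℓ (suc (toℕ k) * ℓ)) lt)
    ρ≼χ : lab ρ ≼ χ ∘ toℕ
    ρ≼χ {x} {y} e = C.respects (toℕ< x) (toℕ< y)
      (trans (cong (toℕ ∘ lab ρ) (fin-toℕ x)) (trans (cong toℕ e) (cong (toℕ ∘ lab ρ) (sym (fin-toℕ y)))))

  module _ (ρ : NC (suc last)) where

    lab≼labelℕ : lab ρ ≼ labelℕ ρ ∘ toℕ
    lab≼labelℕ {x} {y} p = trans (cong (toℕ ∘ lab ρ) (fin-toℕ x))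
      (trans (cong toℕ p) (cong (toℕ ∘ lab ρ) (sym (fin-toℕ y))))

    labelℕ≼lab : labelℕ ρ ∘ toℕ ≼ lab ρ
    labelℕ≼lab {x} {y} p = trans (cong (lab ρ) (sym (fin-toℕ x)))
      (trans (Fin.toℕ-injective p) (cong (lab ρ) (fin-toℕ y)))

    decoded : # Λ + # ρ ≡ suc (suc last) → Decoding ℓ m (labelℕ ρ) → Σ (Code ℓ m) λ c → codePartition c ≈ ρ
    decoded _ (inj₁ (c , e)) = c , ≼-antisym (codePartition c) ρ
      (λ p → labelℕ≼lab (proj₂ (e (toℕ< _) (toℕ< _)) (≼label c p)))
      (λ p → label≼ c (proj₁ (e (toℕ< _) (toℕ< _)) (lab≼labelℕ p)))
    -- Too few classes would contradict the block count that a partner must have.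
    decoded total (inj₂ (k , C , lt)) = contradiction
      (trans (sym (cong₂ _+_ #Λ (#-classes ρ labelℕ≼lab lab≼labelℕ C))) total)
      (ℕ.<⇒≢ (s≤s (subst (_< suc last) (ℕ.+-comm k m) (subst (k + m <_) size≡ lt))))

    partnerCode : MeandricPartner Λ ρ → Σ (Code ℓ m) λ c → codePartition c ≈ ρ
    partnerCode mp = decoded (proj₁ (partner⇒ ρ mp))
      (decode m ℓ (labelℕ ρ) (labelℕ-nonCrossing ρ) (labelℕ-connected ρ (proj₂ (partner⇒ ρ mp))))

  partners : HasCardinality (MeandricPartners Λ) (count m ℓ)
  partners = record
    { to = λ i → codePartition (code i) , codePartition-partner (code i)
    ; cong = λ { {i} refl → id , id }
    ; bijective = injective , surjective }
    where
    code : Fin (count m ℓ) → Code ℓ m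
    code = Inverse.to (enumerate m ℓ)
    injective : ∀ {i j} → codePartition (code i) ≈ codePartition (code j) → i ≡ j
    injective {i} {j} e = trans (sym (strictlyInverseʳ i)) (trans (cong from
      (label-injective (code i) (code j) codes-≐)) (strictlyInverseʳ j))
      where
      open Inverse (enumerate m ℓ)
      coarser : ∀ c d → codePartition c ≈ codePartition d → ∀ {i j} → i < size ℓ m → j < size ℓ m →
        label c i ≡ label c j → label d i ≡ label d j
      coarser c d c≈d {i} {j} i< j< p = trans (cong (label d) (sym (toℕ-fin i<)))
        (trans (≼label d (≈⇒≼ (codePartition c) (codePartition d) c≈d (label≼ c
          (trans (cong (label c) (toℕ-fin i<)) (trans p (cong (label c) (sym (toℕ-fin j<))))))))
          (cong (label d) (toℕ-fin j<)))
      codes-≐ : label (code i) ≐[ size ℓ m ] label (code j)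
      codes-≐ i< j< = coarser (code i) (code j) e i< j<
        , coarser (code j) (code i) (Product.swap e) i< j<
    surjective : ∀ ((ρ , mp) : ∃ (MeandricPartner Λ)) →
      ∃[ i ] (∀ {j} → j ≡ i → codePartition (code j) ≈ ρ)
    surjective (ρ , mp) = let (c , e) = partnerCode ρ mp in
      Inverse.from (enumerate m ℓ) c ,
      λ { refl → subst (λ c → codePartition c ≈ ρ) (sym (Inverse.strictlyInverseˡ (enumerate m ℓ) c)) e }

proposition1p6 : ∀ (ℓ m : ℕ) .{{_ : NonZero ℓ}} .{{_ : NonZero m}} →
    ∃[ N ] HasCardinality (MeandricPartners (λ-interval ℓ m)) N
    × fromℕ N ≡ FCat ℓ m ℚ.* fromℕ (ℓ ^ (m ∸ 1))
proposition1p6 (suc l) (suc m) = count m (suc l) , partners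
    , fromℕ≡FCat* {count m (suc l)} {suc l ^ m} ((suc l * suc m) Comb.C suc m) (l * suc m) (count-FCat m)
  where
  open Counting l
  open Interval l m
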